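{- Let $(A_n)_{n=0}^{+\infty}$ be the sequence A198636 of the OEIS, i.e. $A_n=\frac{w(6,2n)}{2}$, where $w(6,l)$ is the total number of closed walks of length $l$ on the path graph $P_6$. Then $(A_n)_{n=0}^{+\infty}$ is a linear recurrent sequence which coincides with the sequence $(A(2,n))_{n=0}^{+\infty}$; in particular $$A_0=3,\quad A_1=5,\quad A_2=13,\quad A_{n+3}=5A_{n+2}-6A_{n+1}+A_n\quad(n\geq0).$$ Moreover, for all $n\geq0$, $$A_n=2^{2n}\left(\cos^{2n}\left(\frac{\pi}{7}\right)+\cos^{2n}\left(\frac{2\pi}{7}\right)+\cos^{2n}\left(\frac{3\pi}{7}\right)\right).$$
   Context: $P_6$ is the simple path with 6 vertices and 5 edges. A closed walk of length $l$ is a walk with $l$ steps along edges that ends at its starting vertex; $w(6,l)$ counts closed walks over all starting vertices, so $w(6,l)=\mathrm{Tr}(J_6^l)$ with $J_6$ the adjacency matrix of $P_6$ (in particular $w(6,0)=6$). $A(2,n)=\alpha^{2n}+\beta^{2n}+\gamma^{2n}$, where $\alpha,\beta,\gamma$ are the zeros of $x^3+x^2-2x-1$, namely $2\cos\frac{2\pi}{7}$, $2\cos\frac{4\pi}{7}$, $2\cos\frac{8\pi}{7}$. -}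

module Defs where

import Algebra.Definitions.RawSemiring as RawSemiringDefs
import Algebra.Properties.Semiring.Exp as SemiringExp
open import Algebra.Bundles using (CommutativeRing)
open import Algebra.Bundles.Raw using (RawRing)
open import Data.Bool.Base using (if_then_else_)
open import Data.Fin.Base using (Fin; toℕ)
import Data.Fin.Properties as Fin
open import Data.Integer.Base as ℤ using (+_)
import Data.Integer.Properties as ℤ
open import Data.List.Base using (List; [_]; allFin; cartesianProductWith; filter; length)
open import Data.Nat.Base as ℕ using (ℕ; zero; suc; _!)
import Data.Nat.Properties as ℕ
open import Data.Product using (∃; _×_; _,_; proj₁; proj₂)
open import Data.Rational.Base hiding (truncate)
open import Data.Rational.Properties
import Data.Rational.Unnormalised.Base as ℚᵘ
import Data.Rational.Unnormalised.Properties as ℚᵘ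
open import Data.Rational.Solver using (module +-*-Solver)
open import Data.Sum.Base using (inj₁; inj₂)
open import Data.Vec.Base using (Vec; []; _∷_; head; last)
open import Data.Vec.Relation.Unary.Linked using (Linked; linked?)
open import Level using (0ℓ)
open import Relation.Binary.PropositionalEquality hiding ([_])
open import Relation.Nullary.Decidable using (Dec; yes; no; does; from-yes; _×-dec_)
open import Relation.Unary using (Decidable)
open +-*-Solver using (solve; con; _:+_; _:*_; :-_; _:-_; _:=_)

Adjacent : ∀ {m} → Fin m → Fin m → Set
Adjacent i j = ℕ.∣ toℕ i - toℕ j ∣ ≡ 1

adjacent? : ∀ {m} (i j : Fin m) → Dec (Adjacent i j)
adjacent? i j = ℕ.∣ toℕ i - toℕ j ∣ ℕ.≟ 1

-- A walk of length l is recorded by the l + 1 vertices it visits.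
IsClosedWalk : ∀ {m l} → Vec (Fin m) (suc l) → Set
IsClosedWalk v = Linked Adjacent v × head v ≡ last v

isClosedWalk? : ∀ {m l} → Decidable (IsClosedWalk {m} {l})
isClosedWalk? v = linked? adjacent? v ×-dec (head v Fin.≟ last v)

-- Each vector over Fin m occurs exactly once.
allVecs : ∀ m l → List (Vec (Fin m) l)
allVecs m zero    = [ [] ]
allVecs m (suc l) = cartesianProductWith _∷_ (allFin m) (allVecs m l)

w : ℕ → ℕ → ℕ
w m l = length (filter isClosedWalk? (allVecs m (suc l)))

-- Exact division in ℚ, so that no rounding can occur.
A : ℕ → ℚ
A n = + w 6 (2 ℕ.* n) / 2

module ℚ-Exp = SemiringExp (CommutativeRing.semiring +-*-commutativeRing)
open ℚ-Exp using (_^_)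

inv : (n : ℕ) .{{_ : ℕ.NonZero n}} → ℚ
inv n = + 1 / n

ι : ℕ → ℚ
ι n = + n / 1

lin : ∀ {a b} c → 0ℚ ≤ c → b ≡ a + c → a ≤ b
lin {a} {b} c 0≤c eq = subst₂ _≤_ (+-identityʳ a) (sym eq) (+-monoʳ-≤ a 0≤c)

≤-respʳ : ∀ {a b c} → b ≡ c → a ≤ b → a ≤ c
≤-respʳ refl p = p

0≤-diff : ∀ {a b} → a ≤ b → 0ℚ ≤ b - a
0≤-diff {a} {b} p = subst (_≤ b - a) (+-inverseʳ a) (+-monoˡ-≤ (- a) p)

0≤+ : ∀ {a b} → 0ℚ ≤ a → 0ℚ ≤ b → 0ℚ ≤ a + b
0≤+ = +-mono-≤

0≤* : ∀ {a b} → 0ℚ ≤ a → 0ℚ ≤ b → 0ℚ ≤ a * b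
0≤* {a} {b} p q = nonNegative⁻¹ (a * b)
  {{nonNeg*nonNeg⇒nonNeg a {{nonNegative p}} b {{nonNegative q}}}}

0<* : ∀ {a b} → 0ℚ < a → 0ℚ < b → 0ℚ < a * b
0<* {a} {b} p q = positive⁻¹ (a * b) {{pos*pos⇒pos a {{positive p}} b {{positive q}}}}

*-monoʳ : ∀ {a b c} → 0ℚ ≤ a → b ≤ c → a * b ≤ a * c
*-monoʳ {a} 0≤a = *-monoˡ-≤-nonNeg a {{nonNegative 0≤a}}

*-mono : ∀ {a b c d} → 0ℚ ≤ a → 0ℚ ≤ d → a ≤ b → c ≤ d → a * c ≤ b * d
*-mono {a} {b} {c} {d} 0≤a 0≤d p q =
  ≤-trans (*-monoʳ 0≤a q) (*-monoʳ-≤-nonNeg d {{nonNegative 0≤d}} p)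

∣∣≤ : ∀ {a b} → - b ≤ a → a ≤ b → ∣ a ∣ ≤ b
∣∣≤ {a} {b} p q with ∣p∣≡p∨∣p∣≡-p a
... | inj₁ e rewrite e = q
... | inj₂ e rewrite e = lin (a - - b) (0≤-diff p) (solve 2 (λ a b → b := :- a :+ (a :- :- b)) refl a b)

a≤∣a∣ : ∀ a → a ≤ ∣ a ∣
a≤∣a∣ a with ≤-total 0ℚ a
... | inj₁ p = ≤-reflexive (sym (0≤p⇒∣p∣≡p p))
... | inj₂ p = ≤-trans p (0≤∣p∣ a)

∣-∣-swap : ∀ a b → ∣ a - b ∣ ≡ ∣ b - a ∣
∣-∣-swap a b = trans (cong ∣_∣ (solve 2 (λ a b → a :- b := :- (b :- a)) refl a b)) (∣-p∣≡∣p∣ (b - a))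

∣-∣-triangle : ∀ a b c → ∣ a - c ∣ ≤ ∣ a - b ∣ + ∣ b - c ∣
∣-∣-triangle a b c = subst (λ z → ∣ z ∣ ≤ ∣ a - b ∣ + ∣ b - c ∣)
  (solve 3 (λ a b c → (a :- b) :+ (b :- c) := a :- c) refl a b c)
  (∣p+q∣≤∣p∣+∣q∣ (a - b) (b - c))

∣a∣² : ∀ a → ∣ a ∣ * ∣ a ∣ ≡ a * a
∣a∣² a with ∣p∣≡p∨∣p∣≡-p a
... | inj₁ e rewrite e = refl
... | inj₂ e rewrite e = solve 1 (λ a → (:- a) :* (:- a) := a :* a) refl a

ι-mono : ∀ {m n} → m ℕ.≤ n → ι m ≤ ι n
ι-mono {m} {n} p = toℚᵘ-cancel-≤ (ℚᵘ.≤-respˡ-≃ (ℚᵘ.≃-sym (toℚᵘ-fromℚᵘ (ℚᵘ.mkℚᵘ (+ m) 0)))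
  (ℚᵘ.≤-respʳ-≃ (ℚᵘ.≃-sym (toℚᵘ-fromℚᵘ (ℚᵘ.mkℚᵘ (+ n) 0)))
    (ℚᵘ.*≤* (subst₂ ℤ._≤_ (sym (ℤ.*-identityʳ (+ m))) (sym (ℤ.*-identityʳ (+ n))) (ℤ.+≤+ p)))))

ι-suc : ∀ n → ι (suc n) ≡ 1ℚ + ι n
ι-suc n = toℚᵘ-injective (ℚᵘ.≃-trans (toℚᵘ-fromℚᵘ (ℚᵘ.mkℚᵘ (+ suc n) 0))
  (ℚᵘ.≃-trans (ℚᵘ.*≡* (cong (λ z → (+ 1 ℤ.+ z) ℤ.* + 1) (sym (ℤ.*-identityʳ (+ n)))))
  (ℚᵘ.≃-sym (ℚᵘ.≃-trans (toℚᵘ-homo-+ 1ℚ (ι n))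
    (ℚᵘ.+-congʳ (toℚᵘ 1ℚ) (toℚᵘ-fromℚᵘ (ℚᵘ.mkℚᵘ (+ n) 0)))))))

inv-* : ∀ m n .{{_ : ℕ.NonZero m}} .{{_ : ℕ.NonZero n}} .{{_ : ℕ.NonZero (m ℕ.* n)}} →
        inv (m ℕ.* n) ≡ inv m * inv n
inv-* m@(suc m-1) n@(suc n-1) = toℚᵘ-injective (ℚᵘ.≃-trans (toℚᵘ-fromℚᵘ (ℚᵘ.mkℚᵘ (+ 1) _))
  (ℚᵘ.≃-sym (ℚᵘ.≃-trans (toℚᵘ-homo-* (inv m) (inv n))
    (ℚᵘ.*-cong (toℚᵘ-fromℚᵘ (ℚᵘ.mkℚᵘ (+ 1) m-1)) (toℚᵘ-fromℚᵘ (ℚᵘ.mkℚᵘ (+ 1) n-1))))))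

ι*inv : ∀ n .{{_ : ℕ.NonZero n}} → ι n * inv n ≡ 1ℚ
ι*inv n@(suc n-1) = toℚᵘ-injective (ℚᵘ.≃-trans (toℚᵘ-homo-* (ι n) (inv n))
  (ℚᵘ.≃-trans (ℚᵘ.*-cong (toℚᵘ-fromℚᵘ (ℚᵘ.mkℚᵘ (+ n) 0)) (toℚᵘ-fromℚᵘ (ℚᵘ.mkℚᵘ (+ 1) n-1)))
    (ℚᵘ.*≡* (cong +_ (trans (ℕ.*-identityʳ (n ℕ.* 1)) (trans (ℕ.*-identityʳ n)
       (sym (trans (ℕ.*-identityˡ (1 ℕ.* n)) (ℕ.*-identityˡ n)))))))))

0≤ι : ∀ n → 0ℚ ≤ ι n
0≤ι n = ι-mono {0} {n} ℕ.z≤n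

0<inv : ∀ n .{{_ : ℕ.NonZero n}} → 0ℚ < inv n
0<inv n@(suc _) = positive⁻¹ (inv n) {{normalize-pos 1 n}}

0≤inv : ∀ n .{{_ : ℕ.NonZero n}} → 0ℚ ≤ inv n
0≤inv n = <⇒≤ (0<inv n)

inv-anti : ∀ m n .{{_ : ℕ.NonZero m}} .{{_ : ℕ.NonZero n}} → m ℕ.≤ n → inv n ≤ inv m
inv-anti m n m≤n = subst₂ _≤_ left right (*-monoʳ (0≤* (0≤inv m) (0≤inv n)) (ι-mono m≤n))
  where
  left : inv m * inv n * ι m ≡ inv n
  left = trans (solve 3 (λ x y z → x :* y :* z := y :* (z :* x)) refl (inv m) (inv n) (ι m))
    (trans (cong (inv n *_) (ι*inv m)) (*-identityʳ (inv n)))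
  right : inv m * inv n * ι n ≡ inv m
  right = trans (solve 3 (λ x y z → x :* y :* z := x :* (z :* y)) refl (inv m) (inv n) (ι n))
    (trans (cong (inv m *_) (ι*inv n)) (*-identityʳ (inv m)))

archimedean : ∀ q → ∃ λ n → q ≤ ι n
archimedean q@(mkℚ n d _) = ℤ.∣ n ∣ ,
  toℚᵘ-cancel-≤ (ℚᵘ.≤-respʳ-≃ (ℚᵘ.≃-sym (toℚᵘ-fromℚᵘ (ℚᵘ.mkℚᵘ (+ ℤ.∣ n ∣) 0)))
    (ℚᵘ.*≤* (subst (ℤ._≤ + ℤ.∣ n ∣ ℤ.* + suc d) (sym (ℤ.*-identityʳ n))
      (ℤ.≤-trans (i≤∣i∣ n) (subst (+ ℤ.∣ n ∣ ℤ.≤_) (ℤ.pos-* ℤ.∣ n ∣ (suc d))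
        (ℤ.+≤+ (ℕ.m≤m*n ℤ.∣ n ∣ (suc d))))))))
  where
  i≤∣i∣ : ∀ i → i ℤ.≤ + ℤ.∣ i ∣
  i≤∣i∣ (+ _)       = ℤ.≤-refl
  i≤∣i∣ (ℤ.-[1+ _ ]) = ℤ.-≤+

recip : ∀ b → 0ℚ < b → ℚ
recip b 0<b = (1/ b) {{pos⇒nonZero b {{positive 0<b}}}}

0<recip : ∀ b (0<b : 0ℚ < b) → 0ℚ < recip b 0<b
0<recip b 0<b = positive⁻¹ (recip b 0<b) {{1/pos⇒pos b {{positive 0<b}}}}

*-recip : ∀ b (0<b : 0ℚ < b) → b * recip b 0<b ≡ 1ℚ
*-recip b 0<b = *-inverseʳ b {{pos⇒nonZero b {{positive 0<b}}}}

record IsCauchy (s : ℕ → ℚ) : Set where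
  constructor mkCauchy
  field
    modulus : ∀ ε → 0ℚ < ε → ∃ λ N → ∀ m n → N ℕ.≤ m → N ℕ.≤ n → ∣ s m - s n ∣ < ε

open IsCauchy public

-- It suffices to bound differences by a fixed multiple of ε.
cauchy-by : ∀ {s} K → 0ℚ < K →
  (∀ ε → 0ℚ < ε → ∃ λ N → ∀ m n → N ℕ.≤ m → N ℕ.≤ n → ∣ s m - s n ∣ ≤ K * ε) →
  IsCauchy s
cauchy-by {s} K 0<K h = mkCauchy λ ε 0<ε →
  let δ = ½ * (ε * recip K 0<K)
      N , hN = h δ (0<* (positive⁻¹ ½) (0<* 0<ε (0<recip K 0<K)))
  in N , λ m n p q → ≤-<-trans (hN m n p q) (Kδ<ε ε 0<ε)
  where
  Kδ<ε : ∀ ε → 0ℚ < ε → K * (½ * (ε * recip K 0<K)) < ε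
  Kδ<ε ε 0<ε = subst₂ _<_ (trans (+-identityʳ (½ * ε)) (sym Kδ≡))
    (solve 1 (λ e → con ½ :* e :+ con ½ :* e := e) refl ε)
    (+-monoʳ-< (½ * ε) (0<* (positive⁻¹ ½) 0<ε))
    where
    Kδ≡ : K * (½ * (ε * recip K 0<K)) ≡ ½ * ε
    Kδ≡ = trans (solve 3 (λ k e r → k :* (con ½ :* (e :* r)) := con ½ :* e :* (k :* r)) refl K ε (recip K 0<K))
      (trans (cong (½ * ε *_) (*-recip K 0<K)) (*-identityʳ (½ * ε)))

cauchy-const : ∀ q → IsCauchy (λ _ → q)
cauchy-const q = mkCauchy λ ε 0<ε → 0 , λ _ _ _ _ → subst (λ z → ∣ z ∣ < ε) (sym (+-inverseʳ q)) 0<ε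

cauchy-+ : ∀ {s t} → IsCauchy s → IsCauchy t → IsCauchy (λ n → s n + t n)
cauchy-+ {s} {t} cs ct = cauchy-by (1ℚ + 1ℚ) (positive⁻¹ (1ℚ + 1ℚ)) λ ε 0<ε →
  let M , hM = modulus cs ε 0<ε
      N , hN = modulus ct ε 0<ε
  in M ℕ.⊔ N , λ m n p q → ≤-trans
    (subst (λ z → ∣ z ∣ ≤ ∣ s m - s n ∣ + ∣ t m - t n ∣)
      (solve 4 (λ a b c d → (a :- b) :+ (c :- d) := (a :+ c) :- (b :+ d)) refl (s m) (s n) (t m) (t n))
      (∣p+q∣≤∣p∣+∣q∣ (s m - s n) (t m - t n)))
    (≤-respʳ (solve 1 (λ e → e :+ e := (con 1ℚ :+ con 1ℚ) :* e) refl ε)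
      (+-mono-≤
        (<⇒≤ (hM m n (ℕ.m⊔n≤o⇒m≤o M N p) (ℕ.m⊔n≤o⇒m≤o M N q)))
        (<⇒≤ (hN m n (ℕ.m⊔n≤o⇒n≤o M N p) (ℕ.m⊔n≤o⇒n≤o M N q)))))

cauchy-neg : ∀ {s} → IsCauchy s → IsCauchy (λ n → - s n)
cauchy-neg {s} cs = mkCauchy λ ε 0<ε → let N , h = modulus cs ε 0<ε in N , λ m n p q →
  subst (λ z → ∣ z ∣ < ε)
    (solve 2 (λ a b → b :- a := :- a :- (:- b)) refl (s m) (s n))
    (h n m q p)

bounded : ∀ {s} → IsCauchy s → ∃ λ B → 0ℚ < B × ∀ n → ∣ s n ∣ ≤ B
bounded {s} cs = B , +-mono-≤-< (0≤+ (0≤below N) (0≤∣p∣ (s N))) (positive⁻¹ 1ℚ) , bound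
  where
  N : ℕ
  N = proj₁ (modulus cs 1ℚ (positive⁻¹ 1ℚ))
  below : ℕ → ℚ
  below zero    = 0ℚ
  below (suc n) = below n + ∣ s n ∣
  0≤below : ∀ n → 0ℚ ≤ below n
  0≤below zero    = ≤-refl
  0≤below (suc n) = 0≤+ (0≤below n) (0≤∣p∣ (s n))
  ≤below : ∀ {k} n → k ℕ.< n → ∣ s k ∣ ≤ below n
  ≤below {k} (suc n) (ℕ.s≤s k≤n) with k ℕ.≟ n
  ... | yes refl = lin (below k) (0≤below k) (+-comm (below k) ∣ s k ∣)
  ... | no k≢n   = ≤-trans (≤below n (ℕ.≤∧≢⇒< k≤n k≢n)) (lin ∣ s n ∣ (0≤∣p∣ (s n)) refl)
  B : ℚ
  B = below N + ∣ s N ∣ + 1ℚ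
  bound : ∀ n → ∣ s n ∣ ≤ B
  bound n with n ℕ.<? N
  ... | yes n<N = ≤-trans (≤below N n<N) (lin (∣ s N ∣ + 1ℚ) (0≤+ (0≤∣p∣ (s N)) (nonNegative⁻¹ 1ℚ)) (+-assoc (below N) ∣ s N ∣ 1ℚ))
  ... | no n≮N  = ≤-trans
    (subst (λ z → ∣ z ∣ ≤ ∣ s n - s N ∣ + ∣ s N ∣)
      (solve 2 (λ a b → (a :- b) :+ b := a) refl (s n) (s N))
      (∣p+q∣≤∣p∣+∣q∣ (s n - s N) (s N)))
    (lin (below N + (1ℚ - ∣ s n - s N ∣))
      (0≤+ (0≤below N) (0≤-diff (<⇒≤ (proj₂ (modulus cs 1ℚ (positive⁻¹ 1ℚ)) n N (ℕ.≮⇒≥ n≮N) ℕ.≤-refl))))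
      (solve 3 (λ b a d → b :+ a :+ con 1ℚ := (d :+ a) :+ (b :+ (con 1ℚ :- d))) refl
        (below N) ∣ s N ∣ ∣ s n - s N ∣))

cauchy-* : ∀ {s t} → IsCauchy s → IsCauchy t → IsCauchy (λ n → s n * t n)
cauchy-* {s} {t} cs ct =
  let B , 0<B , hB = bounded cs
      C , 0<C , hC = bounded ct
  in cauchy-by (B + C) (+-mono-< 0<B 0<C) λ ε 0<ε →
  let M , hM = modulus cs ε 0<ε
      N , hN = modulus ct ε 0<ε
  in M ℕ.⊔ N , λ m n p q →
  let 1st : ∣ s m * (t m - t n) ∣ ≤ B * ε
      1st = subst (_≤ B * ε) (sym (∣p*q∣≡∣p∣*∣q∣ (s m) (t m - t n)))
        (*-mono (0≤∣p∣ (s m)) (<⇒≤ 0<ε) (hB m) (<⇒≤ (hN m n (ℕ.m⊔n≤o⇒n≤o M N p) (ℕ.m⊔n≤o⇒n≤o M N q))))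
      2nd : ∣ t n * (s m - s n) ∣ ≤ C * ε
      2nd = subst (_≤ C * ε) (sym (∣p*q∣≡∣p∣*∣q∣ (t n) (s m - s n)))
        (*-mono (0≤∣p∣ (t n)) (<⇒≤ 0<ε) (hC n) (<⇒≤ (hM m n (ℕ.m⊔n≤o⇒m≤o M N p) (ℕ.m⊔n≤o⇒m≤o M N q))))
  in ≤-trans
    (subst (λ z → ∣ z ∣ ≤ ∣ s m * (t m - t n) ∣ + ∣ t n * (s m - s n) ∣)
      (solve 4 (λ a b c d → a :* (c :- d) :+ d :* (a :- b) := a :* c :- b :* d) refl (s m) (s n) (t m) (t n))
      (∣p+q∣≤∣p∣+∣q∣ (s m * (t m - t n)) (t n * (s m - s n))))
    (≤-respʳ (sym (*-distribʳ-+ ε B C)) (+-mono-≤ 1st 2nd))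

cauchy-^ : ∀ {s} → IsCauchy s → ∀ k → IsCauchy (λ n → s n ^ k)
cauchy-^ cs zero    = cauchy-const 1ℚ
cauchy-^ cs (suc k) = cauchy-* cs (cauchy-^ cs k)

record ℝ : Set where
  constructor mkℝ
  field
    seq    : ℕ → ℚ
    cauchy : IsCauchy seq

open ℝ public

infix  4 _≈ᵣ_ _<ᵣ_
infix  8 -ᵣ_
infixl 7 _*ᵣ_
infixl 6 _+ᵣ_ _-ᵣ_

record _≈ᵣ_ (x y : ℝ) : Set where
  constructor mk≈
  field
    close : ∀ ε → 0ℚ < ε → ∃ λ N → ∀ n → N ℕ.≤ n → ∣ seq x n - seq y n ∣ < ε

record _<ᵣ_ (x y : ℝ) : Set where
  constructor mk<
  field
    gap   : ℚ
    0<gap : 0ℚ < gap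
    apart : ∃ λ N → ∀ n → N ℕ.≤ n → gap ≤ seq y n - seq x n

fromℚ : ℚ → ℝ
fromℚ q = mkℝ (λ _ → q) (cauchy-const q)

_+ᵣ_ : ℝ → ℝ → ℝ
x +ᵣ y = mkℝ (λ n → seq x n + seq y n) (cauchy-+ (cauchy x) (cauchy y))

-ᵣ_ : ℝ → ℝ
-ᵣ x = mkℝ (λ n → - seq x n) (cauchy-neg (cauchy x))

_*ᵣ_ : ℝ → ℝ → ℝ
x *ᵣ y = mkℝ (λ n → seq x n * seq y n) (cauchy-* (cauchy x) (cauchy y))

_-ᵣ_ : ℝ → ℝ → ℝ
x -ᵣ y = x +ᵣ (-ᵣ y)

ℝ-rawRing : RawRing 0ℓ 0ℓ
ℝ-rawRing = record
  { Carrier = ℝ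
  ; _≈_     = _≈ᵣ_
  ; _+_     = _+ᵣ_
  ; _*_     = _*ᵣ_
  ; -_      = -ᵣ_
  ; 0#      = fromℚ 0ℚ
  ; 1#      = fromℚ 1ℚ
  }

open RawSemiringDefs (RawRing.rawSemiring ℝ-rawRing) public
  using () renaming (_^_ to infixr 8 _^ᵣ_)

-- The partial sum f 0 + ⋯ + f (n - 1).
Σ< : ℕ → (ℕ → ℚ) → ℚ
Σ< zero    f = 0ℚ
Σ< (suc n) f = Σ< n f + f n

invFact : ℕ → ℚ
invFact k = inv ((2 ℕ.* k) !) {{(2 ℕ.* k) ℕ.!≢0}}

cosTerm : ℚ → ℕ → ℚ
cosTerm q k = (- 1ℚ) ^ k * q ^ (2 ℕ.* k) * invFact k

cosSum : ℕ → ℚ → ℚ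
cosSum n q = Σ< n (cosTerm q)

ratio : ℕ → ℚ
ratio k = inv ((2 ℕ.+ 2 ℕ.* k) ℕ.* (1 ℕ.+ 2 ℕ.* k))

inv-cong : ∀ {m n} .{{_ : ℕ.NonZero m}} .{{_ : ℕ.NonZero n}} → m ≡ n → inv m ≡ inv n
inv-cong refl = refl

invFact-suc : ∀ k → invFact (suc k) ≡ ratio k * invFact k
invFact-suc k = trans
  (inv-cong {{(2 ℕ.* suc k) ℕ.!≢0}} {{ab!≢0}} (trans (cong _! (ℕ.*-suc 2 k))
    (sym (ℕ.*-assoc (2 ℕ.+ 2 ℕ.* k) (1 ℕ.+ 2 ℕ.* k) ((2 ℕ.* k) !)))))
  (inv-* ((2 ℕ.+ 2 ℕ.* k) ℕ.* (1 ℕ.+ 2 ℕ.* k)) ((2 ℕ.* k) !) {{_}} {{(2 ℕ.* k) ℕ.!≢0}} {{ab!≢0}})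
  where
  ab!≢0 : ℕ.NonZero ((2 ℕ.+ 2 ℕ.* k) ℕ.* (1 ℕ.+ 2 ℕ.* k) ℕ.* (2 ℕ.* k) !)
  ab!≢0 = ℕ.m*n≢0 ((2 ℕ.+ 2 ℕ.* k) ℕ.* (1 ℕ.+ 2 ℕ.* k)) ((2 ℕ.* k) !) {{_}} {{(2 ℕ.* k) ℕ.!≢0}}

0≤ratio : ∀ k → 0ℚ ≤ ratio k
0≤ratio k = 0≤inv ((2 ℕ.+ 2 ℕ.* k) ℕ.* (1 ℕ.+ 2 ℕ.* k))

ratio-anti : ∀ {j k} → j ℕ.≤ k → ratio k ≤ ratio j
ratio-anti {j} {k} p =
  inv-anti ((2 ℕ.+ 2 ℕ.* j) ℕ.* (1 ℕ.+ 2 ℕ.* j)) ((2 ℕ.+ 2 ℕ.* k) ℕ.* (1 ℕ.+ 2 ℕ.* k))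
    (ℕ.*-mono-≤ (ℕ.+-monoʳ-≤ 2 (ℕ.*-monoʳ-≤ 2 p)) (ℕ.+-monoʳ-≤ 1 (ℕ.*-monoʳ-≤ 2 p)))

0≤invFact : ∀ k → 0ℚ ≤ invFact k
0≤invFact k = 0≤inv ((2 ℕ.* k) !) {{(2 ℕ.* k) ℕ.!≢0}}

^-double : ∀ q k → q ^ (2 ℕ.* k) ≡ (q * q) ^ k
^-double q k = trans (sym (ℚ-Exp.^-assocʳ q 2 k)) (cong (_^ k) (cong (q *_) (*-identityʳ q)))

0≤^ : ∀ {q} → 0ℚ ≤ q → ∀ k → 0ℚ ≤ q ^ k
0≤^ p zero    = nonNegative⁻¹ 1ℚ
0≤^ p (suc k) = 0≤* p (0≤^ p k)

^-mono : ∀ {a b} → 0ℚ ≤ a → a ≤ b → ∀ k → a ^ k ≤ b ^ k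
^-mono p q zero    = ≤-refl
^-mono p q (suc k) = *-mono p (0≤^ (≤-trans p q) k) q (^-mono p q k)

∣^∣ : ∀ q k → ∣ q ^ k ∣ ≡ ∣ q ∣ ^ k
∣^∣ q zero    = refl
∣^∣ q (suc k) = trans (∣p*q∣≡∣p∣*∣q∣ q (q ^ k)) (cong (∣ q ∣ *_) (∣^∣ q k))

1^ : ∀ k → 1ℚ ^ k ≡ 1ℚ
1^ zero    = refl
1^ (suc k) = trans (*-identityˡ (1ℚ ^ k)) (1^ k)

-- A bound for the terms of the cosine series on the interval [-B, B].
dom : ℚ → ℕ → ℚ
dom B k = (B * B) ^ k * invFact k

0≤² : ∀ B → 0ℚ ≤ B * B
0≤² B = subst (0ℚ ≤_) (∣a∣² B) (0≤* (0≤∣p∣ B) (0≤∣p∣ B))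

0≤dom : ∀ B k → 0ℚ ≤ dom B k
0≤dom B k = 0≤* (0≤^ (0≤² B) k) (0≤invFact k)

dom-suc : ∀ B k → dom B (suc k) ≡ B * B * ratio k * dom B k
dom-suc B k = trans (cong ((B * B) ^ suc k *_) (invFact-suc k))
  (solve 4 (λ b p r f → (b :* p) :* (r :* f) := b :* r :* (p :* f)) refl (B * B) ((B * B) ^ k) (ratio k) (invFact k))

∣cosTerm∣≤dom : ∀ {B q} → ∣ q ∣ ≤ B → ∀ k → ∣ cosTerm q k ∣ ≤ dom B k
∣cosTerm∣≤dom {B} {q} q≤B k = subst (_≤ dom B k) (sym eq)
  (*-monoʳ-≤-nonNeg (invFact k) {{nonNegative (0≤invFact k)}}
    (^-mono (0≤* (0≤∣p∣ q) (0≤∣p∣ q)) (*-mono (0≤∣p∣ q) (≤-trans (0≤∣p∣ q) q≤B) q≤B q≤B) k))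
  where
  open ≡-Reasoning
  eq : ∣ cosTerm q k ∣ ≡ (∣ q ∣ * ∣ q ∣) ^ k * invFact k
  eq = begin
    ∣ (- 1ℚ) ^ k * q ^ (2 ℕ.* k) * invFact k ∣          ≡⟨ ∣p*q∣≡∣p∣*∣q∣ ((- 1ℚ) ^ k * q ^ (2 ℕ.* k)) (invFact k) ⟩
    ∣ (- 1ℚ) ^ k * q ^ (2 ℕ.* k) ∣ * ∣ invFact k ∣      ≡⟨ cong₂ _*_ (∣p*q∣≡∣p∣*∣q∣ ((- 1ℚ) ^ k) (q ^ (2 ℕ.* k))) (0≤p⇒∣p∣≡p (0≤invFact k)) ⟩
    ∣ (- 1ℚ) ^ k ∣ * ∣ q ^ (2 ℕ.* k) ∣ * invFact k      ≡⟨ cong (_* invFact k) (cong₂ _*_ (trans (∣^∣ (- 1ℚ) k) (1^ k)) (∣^∣ q (2 ℕ.* k))) ⟩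
    1ℚ * ∣ q ∣ ^ (2 ℕ.* k) * invFact k                  ≡⟨ cong (_* invFact k) (trans (*-identityˡ _) (^-double ∣ q ∣ k)) ⟩
    (∣ q ∣ * ∣ q ∣) ^ k * invFact k                     ∎

-- The hypothesis on u holds with c = 1 / (1 - ρ) if u (k + 1) ≤ ρ u k.
tail-bound : ∀ (t u : ℕ → ℚ) c K →
  (∀ k → K ℕ.≤ k → ∣ t k ∣ ≤ u k) →
  (∀ k → K ℕ.≤ k → u k ≤ c * (u k - u (suc k))) →
  ∀ j → ∣ Σ< (j ℕ.+ K) t - Σ< K t ∣ ≤ c * (u K - u (j ℕ.+ K))
tail-bound t u c K ht hu zero = ≤-reflexive (trans (cong ∣_∣ (+-inverseʳ (Σ< K t)))
  (solve 2 (λ c x → con 0ℚ := c :* (x :- x)) refl c (u K)))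
tail-bound t u c K ht hu (suc j) = ≤-trans
  (subst (λ z → ∣ z ∣ ≤ ∣ Σ< m t - Σ< K t ∣ + ∣ t m ∣)
    (solve 3 (λ a b d → (a :- b) :+ d := (a :+ d) :- b) refl (Σ< m t) (Σ< K t) (t m))
    (∣p+q∣≤∣p∣+∣q∣ (Σ< m t - Σ< K t) (t m)))
  (≤-respʳ (solve 4 (λ c x y z → c :* (x :- y) :+ c :* (y :- z) := c :* (x :- z)) refl c (u K) (u m) (u (suc m)))
    (+-mono-≤ (tail-bound t u c K ht hu j) (≤-trans (ht m K≤m) (hu m K≤m))))
  where
  m = j ℕ.+ K
  K≤m : K ℕ.≤ m
  K≤m = ℕ.m≤n+m K j

2ℚ : ℚ
2ℚ = + 2 / 1

halving : ∀ {a b} → b ≤ ½ * a → a ≤ 2ℚ * (a - b)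
halving {a} {b} p = lin (2ℚ * (½ * a - b)) (0≤* (nonNegative⁻¹ 2ℚ) (0≤-diff p))
  (solve 2 (λ a b → con 2ℚ :* (a :- b) := a :+ con 2ℚ :* (con ½ :* a :- b)) refl a b)

dom-halves : ∀ B k → B * B * ratio k ≤ ½ → dom B (suc k) ≤ ½ * dom B k
dom-halves B k p = subst (_≤ ½ * dom B k) (sym (dom-suc B k))
  (*-monoʳ-≤-nonNeg (dom B k) {{nonNegative (0≤dom B k)}} p)

eventually-halves : ∀ B → ∃ λ K → ∀ k → K ℕ.≤ k → B * B * ratio k ≤ ½
eventually-halves B = let K , hK = archimedean (B * B) in K , λ k K≤k →
  let open ≤-Reasoning in begin
    B * B * ratio k                     ≤⟨ *-monoʳ-≤-nonNeg (ratio k) {{nonNegative (0≤ratio k)}}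
                                            (≤-trans hK (ι-mono (ℕ.≤-trans K≤k (ℕ.n≤1+n k)))) ⟩
    ι (suc k) * ratio k                 ≤⟨ *-monoʳ (0≤ι (suc k)) (inv-anti (2 ℕ.* suc k) ((2 ℕ.+ 2 ℕ.* k) ℕ.* (1 ℕ.+ 2 ℕ.* k))
                                            (ℕ.≤-trans (ℕ.≤-reflexive (ℕ.*-suc 2 k)) (ℕ.m≤m*n (2 ℕ.+ 2 ℕ.* k) (1 ℕ.+ 2 ℕ.* k)))) ⟩
    ι (suc k) * inv (2 ℕ.* suc k)       ≡⟨ cong (ι (suc k) *_) (inv-* 2 (suc k)) ⟩
    ι (suc k) * (½ * inv (suc k))       ≡⟨ solve 2 (λ x y → x :* (con ½ :* y) := con ½ :* (x :* y)) refl (ι (suc k)) (inv (suc k)) ⟩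
    ½ * (ι (suc k) * inv (suc k))       ≡⟨ cong (½ *_) (ι*inv (suc k)) ⟩
    ½ * 1ℚ                              ≡⟨⟩
    ½                                   ∎

dom-vanishes : ∀ B ε → 0ℚ < ε → ∃ λ N →
  dom B N ≤ ε × (∀ k → N ℕ.≤ k → dom B (suc k) ≤ ½ * dom B k)
dom-vanishes B ε 0<ε = n ℕ.+ K , small , λ k p → halves k (ℕ.≤-trans (ℕ.m≤n+m K n) p)
  where
  K : ℕ
  K = proj₁ (eventually-halves B)
  halves : ∀ k → K ℕ.≤ k → dom B (suc k) ≤ ½ * dom B k
  halves k p = dom-halves B k (proj₂ (eventually-halves B) k p)
  decay : ∀ j → ι (suc j) * dom B (j ℕ.+ K) ≤ dom B K
  decay zero    = ≤-reflexive (*-identityˡ (dom B K))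
  decay (suc j) = ≤-trans
    (≤-trans (*-monoʳ (0≤ι (2 ℕ.+ j)) (halves (j ℕ.+ K) (ℕ.m≤n+m K j)))
      (lin (½ * ((ι (suc j) - 1ℚ) * dom B (j ℕ.+ K)))
        (0≤* (nonNegative⁻¹ ½) (0≤* (0≤-diff (ι-mono {1} {suc j} (ℕ.s≤s ℕ.z≤n))) (0≤dom B (j ℕ.+ K))))
        (subst (λ z → ι (suc j) * dom B (j ℕ.+ K) ≡ z * (½ * dom B (j ℕ.+ K)) + ½ * ((ι (suc j) - 1ℚ) * dom B (j ℕ.+ K)))
          (sym (ι-suc (suc j)))
          (solve 2 (λ i d → i :* d := (con 1ℚ :+ i) :* (con ½ :* d) :+ con ½ :* ((i :- con 1ℚ) :* d)) refl (ι (suc j)) (dom B (j ℕ.+ K))))))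
    (decay j)
  arch = archimedean (dom B K * recip ε 0<ε)
  n : ℕ
  n = proj₁ arch
  K≤ : dom B K ≤ ι (suc n) * ε
  K≤ = subst (_≤ ι (suc n) * ε)
    (trans (*-assoc (dom B K) (recip ε 0<ε) ε)
      (trans (cong (dom B K *_) (trans (*-comm (recip ε 0<ε) ε) (*-recip ε 0<ε))) (*-identityʳ (dom B K))))
    (*-monoʳ-≤-nonNeg ε {{nonNegative (<⇒≤ 0<ε)}} (≤-trans (proj₂ arch) (ι-mono (ℕ.n≤1+n n))))
  small : dom B (n ℕ.+ K) ≤ ε
  small = *-cancelˡ-≤-pos (ι (suc n)) {{positive (<-≤-trans (positive⁻¹ 1ℚ) (ι-mono {1} {suc n} (ℕ.s≤s ℕ.z≤n)))}}
    (≤-trans (decay n) K≤)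

cosSum-tail : ∀ B K → (∀ k → K ℕ.≤ k → dom B (suc k) ≤ ½ * dom B k) →
  ∀ q → ∣ q ∣ ≤ B → ∀ n → K ℕ.≤ n → ∣ cosSum n q - cosSum K q ∣ ≤ 2ℚ * dom B K
cosSum-tail B K h q q≤B n K≤n = ≤-trans
  (subst (λ n → ∣ cosSum n q - cosSum K q ∣ ≤ 2ℚ * (dom B K - dom B n)) (ℕ.m∸n+n≡m K≤n)
    (tail-bound (cosTerm q) (dom B) 2ℚ K (λ k _ → ∣cosTerm∣≤dom q≤B k) (λ k p → halving (h k p)) (n ℕ.∸ K)))
  (*-monoʳ {2ℚ} {dom B K - dom B n} {dom B K} (nonNegative⁻¹ 2ℚ) (lin (dom B n) (0≤dom B n)
    (solve 2 (λ a b → a := (a :- b) :+ b) refl (dom B K) (dom B n))))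

cosSum-uniform : ∀ B ε → 0ℚ < ε → ∃ λ N →
  ∀ q → ∣ q ∣ ≤ B → ∀ n → N ℕ.≤ n → ∣ cosSum n q - cosSum N q ∣ ≤ ε
cosSum-uniform B ε 0<ε =
  let N , small , halves = dom-vanishes B (½ * ε) (0<* (positive⁻¹ ½) 0<ε)
  in N , λ q q≤B n N≤n → ≤-trans (cosSum-tail B N halves q q≤B n N≤n)
    (subst (2ℚ * dom B N ≤_) (solve 1 (λ e → con 2ℚ :* (con ½ :* e) := e) refl ε)
      (*-monoʳ {2ℚ} (nonNegative⁻¹ 2ℚ) small))

cauchy-cosSum : ∀ {s} → IsCauchy s → ∀ k → IsCauchy (λ n → cosSum k (s n))
cauchy-cosSum cs zero    = cauchy-const 0ℚ
cauchy-cosSum cs (suc k) = cauchy-+ (cauchy-cosSum cs k)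
  (cauchy-* (cauchy-* (cauchy-const ((- 1ℚ) ^ k)) (cauchy-^ cs (2 ℕ.* k))) (cauchy-const (invFact k)))

3ℚ : ℚ
3ℚ = + 3 / 1

cauchy-cos : ∀ {s} → IsCauchy s → IsCauchy (λ n → cosSum n (s n))
cauchy-cos {s} cs = let B , 0<B , hB = bounded cs in
  cauchy-by 3ℚ (positive⁻¹ 3ℚ) λ ε 0<ε →
  let K , hK = cosSum-uniform B ε 0<ε
      N , hN = modulus (cauchy-cosSum cs K) ε 0<ε
  in K ℕ.⊔ N , λ m n p q →
  let x = cosSum m (s m)
      y = cosSum K (s m)
      z = cosSum K (s n)
      t = cosSum n (s n)
  in ≤-trans (∣-∣-triangle x y t) (≤-trans (+-monoʳ-≤ ∣ x - y ∣ (∣-∣-triangle y z t))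
    (≤-respʳ (solve 1 (λ e → e :+ (e :+ e) := con 3ℚ :* e) refl ε)
      (+-mono-≤ (hK (s m) (hB m) m (ℕ.m⊔n≤o⇒m≤o K N p))
        (+-mono-≤ (<⇒≤ (hN m n (ℕ.m⊔n≤o⇒n≤o K N p) (ℕ.m⊔n≤o⇒n≤o K N q)))
          (subst (_≤ ε) (∣-∣-swap t z) (hK (s n) (hB n) n (ℕ.m⊔n≤o⇒m≤o K N q)))))))

-- The limit of the power series, taken along the diagonal.
cos : ℝ → ℝ
cos x = mkℝ (λ n → cosSum n (seq x n)) (cauchy-cos (cauchy x))

4/15 10/11 15/11 1/22 : ℚ
4/15  = + 4 / 15
10/11 = + 10 / 11
15/11 = + 15 / 11
1/22  = + 1 / 22

Σ<-- : ∀ n f g → Σ< n f - Σ< n g ≡ Σ< n (λ k → f k - g k)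
Σ<-- zero    f g = refl
Σ<-- (suc n) f g = trans
  (solve 4 (λ a b c d → (a :+ b) :- (c :+ d) := (a :- c) :+ (b :- d)) refl (Σ< n f) (f n) (Σ< n g) (g n))
  (cong (_+ (f n - g n)) (Σ<-- n f g))

-- Truncations of the cosine series decrease on [0, 2], at a definite rate.
module Decrease (a b : ℚ) (0≤a : 0ℚ ≤ a) (a≤b : a ≤ b) (b≤2 : b ≤ 2ℚ) where

  0≤b : 0ℚ ≤ b
  0≤b = ≤-trans 0≤a a≤b

  Δ : ℚ
  Δ = b * b - a * a

  E : ℕ → ℚ
  E k = (b * b) ^ k - (a * a) ^ k

  D : ℕ → ℚ
  D k = E k * invFact k

  a²≤b² : a * a ≤ b * b
  a²≤b² = *-mono 0≤a 0≤b a≤b a≤b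

  0≤E : ∀ k → 0ℚ ≤ E k
  0≤E k = 0≤-diff (^-mono (0≤² a) a²≤b² k)

  0≤D : ∀ k → 0ℚ ≤ D k
  0≤D k = 0≤* (0≤E k) (0≤invFact k)

  b²≤4 : b * b ≤ 2ℚ * 2ℚ
  b²≤4 = *-mono 0≤b (nonNegative⁻¹ 2ℚ) b≤2 b≤2

  E-step : ∀ k → E (2 ℕ.+ k) ≤ (2ℚ * 2ℚ + 2ℚ * 2ℚ) * E (1 ℕ.+ k)
  E-step k = ≤-trans
    (lin (a * a * (b * b) * E k) (0≤* (0≤* (0≤² a) (0≤² b)) (0≤E k))
      (solve 4 (λ a b p q → (b :+ a) :* (b :* q :- a :* p) :=
          (b :* (b :* q) :- a :* (a :* p)) :+ a :* b :* (q :- p))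
        refl (a * a) (b * b) ((a * a) ^ k) ((b * b) ^ k)))
    (*-monoʳ-≤-nonNeg (E (1 ℕ.+ k)) {{nonNegative (0≤E (1 ℕ.+ k))}}
      (+-mono-≤ b²≤4 (≤-trans a²≤b² b²≤4)))

  D-step : ∀ j k → j ℕ.≤ suc k → D (2 ℕ.+ k) ≤ (2ℚ * 2ℚ + 2ℚ * 2ℚ) * ratio j * D (1 ℕ.+ k)
  D-step j k j≤ = begin
    E (2 ℕ.+ k) * invFact (2 ℕ.+ k)                   ≡⟨ cong (E (2 ℕ.+ k) *_) (invFact-suc (1 ℕ.+ k)) ⟩
    E (2 ℕ.+ k) * (ratio (1 ℕ.+ k) * invFact (1 ℕ.+ k)) ≤⟨ *-mono (0≤E (2 ℕ.+ k)) (0≤* (0≤ratio j) (0≤invFact (1 ℕ.+ k)))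
                                                          (E-step k)
                                                          (*-monoʳ-≤-nonNeg (invFact (1 ℕ.+ k)) {{nonNegative (0≤invFact (1 ℕ.+ k))}} (ratio-anti j≤)) ⟩
    8ℚ * E (1 ℕ.+ k) * (ratio j * invFact (1 ℕ.+ k))  ≡⟨ solve 4 (λ c e r f → c :* e :* (r :* f) := c :* r :* (e :* f)) refl
                                                          8ℚ (E (1 ℕ.+ k)) (ratio j) (invFact (1 ℕ.+ k)) ⟩
    8ℚ * ratio j * D (1 ℕ.+ k)                        ∎
    where
    open ≤-Reasoning
    8ℚ : ℚ
    8ℚ = 2ℚ * 2ℚ + 2ℚ * 2ℚ

  D₁ : D 1 ≡ ½ * Δ
  D₁ = solve 2 (λ a b → (b :* b :* con 1ℚ :- a :* a :* con 1ℚ) :* con ½ := con ½ :* (b :* b :- a :* a)) refl a b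

  t : ℕ → ℚ
  t k = cosTerm a k - cosTerm b k

  ∣t∣≤D : ∀ k → ∣ t k ∣ ≤ D k
  ∣t∣≤D k = ≤-reflexive (begin
    ∣ t k ∣                                                   ≡⟨ cong ∣_∣ (cong₂ (λ x y → s * x * f - s * y * f) (^-double a k) (^-double b k)) ⟩
    ∣ s * (a * a) ^ k * f - s * (b * b) ^ k * f ∣             ≡⟨ cong ∣_∣ (solve 4 (λ s p q f → s :* p :* f :- s :* q :* f := (:- s) :* ((q :- p) :* f)) refl s ((a * a) ^ k) ((b * b) ^ k) f) ⟩
    ∣ (- s) * D k ∣                                           ≡⟨ ∣p*q∣≡∣p∣*∣q∣ (- s) (D k) ⟩
    ∣ - s ∣ * ∣ D k ∣                                         ≡⟨ cong₂ _*_ (trans (∣-p∣≡∣p∣ s) (trans (∣^∣ (- 1ℚ) k) (1^ k))) (0≤p⇒∣p∣≡p (0≤D k)) ⟩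
    1ℚ * D k                                                  ≡⟨ *-identityˡ (D k) ⟩
    D k                                                       ∎)
    where
    open ≡-Reasoning
    s = (- 1ℚ) ^ k
    f = invFact k

  D-tail : ∀ k → 2 ℕ.≤ k → D k ≤ 15/11 * (D k - D (suc k))
  D-tail (suc (suc k)) _ = lin (15/11 * (4/15 * D (2 ℕ.+ k) - D (3 ℕ.+ k)))
    (0≤* (nonNegative⁻¹ 15/11) (0≤-diff (D-step 2 (suc k) (ℕ.s≤s (ℕ.s≤s ℕ.z≤n)))))
    (solve 2 (λ x y → con 15/11 :* (x :- y) := x :+ con 15/11 :* (con 4/15 :* x :- y)) refl (D (2 ℕ.+ k)) (D (3 ℕ.+ k)))
  D-tail (suc zero) (ℕ.s≤s ())

  drop : ℕ → ℚ
  drop n = cosSum n a - cosSum n b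

  drop-bound : ∀ n → 2 ℕ.≤ n → ∣ drop n - ½ * Δ ∣ ≤ 10/11 * (½ * Δ)
  drop-bound n 2≤n = begin
    ∣ drop n - ½ * Δ ∣                ≡⟨ cong ∣_∣ (cong₂ _-_ (Σ<-- n (cosTerm a) (cosTerm b)) head≡) ⟩
    ∣ Σ< n t - Σ< 2 t ∣               ≤⟨ subst (λ n → ∣ Σ< n t - Σ< 2 t ∣ ≤ 15/11 * (D 2 - D n)) (ℕ.m∸n+n≡m 2≤n)
                                          (tail-bound t D 15/11 2 (λ k _ → ∣t∣≤D k) D-tail (n ℕ.∸ 2)) ⟩
    15/11 * (D 2 - D n)               ≤⟨ lin (15/11 * D n) (0≤* (nonNegative⁻¹ 15/11) (0≤D n))
                                          (solve 3 (λ c x y → c :* x := c :* (x :- y) :+ c :* y) refl 15/11 (D 2) (D n)) ⟩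
    15/11 * D 2                       ≤⟨ *-monoʳ {15/11} (nonNegative⁻¹ 15/11) (D-step 1 0 (ℕ.s≤s ℕ.z≤n)) ⟩
    15/11 * (+ 2 / 3 * D 1)           ≡⟨ cong (λ z → 15/11 * (+ 2 / 3 * z)) D₁ ⟩
    15/11 * (+ 2 / 3 * (½ * Δ))       ≡⟨ *-assoc 15/11 (+ 2 / 3) (½ * Δ) ⟨
    10/11 * (½ * Δ)                   ∎
    where
    open ≤-Reasoning
    head≡ : ½ * Δ ≡ Σ< 2 t
    head≡ = solve 2 (λ a b → con ½ :* (b :* b :- a :* a) :=
      con 0ℚ :+ con 0ℚ :+ (con (- 1ℚ) :* (a :* (a :* con 1ℚ)) :* con ½ :- con (- 1ℚ) :* (b :* (b :* con 1ℚ)) :* con ½)) refl a b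

  0≤Δ : 0ℚ ≤ Δ
  0≤Δ = 0≤-diff a²≤b²

  drop-lower : ∀ n → 2 ℕ.≤ n → 1/22 * Δ ≤ drop n
  drop-lower n p = lin (10/11 * (½ * Δ) - (½ * Δ - drop n))
    (0≤-diff (≤-trans (a≤∣a∣ (½ * Δ - drop n)) (subst (_≤ 10/11 * (½ * Δ)) (∣-∣-swap (drop n) (½ * Δ)) (drop-bound n p))))
    (solve 2 (λ d x → x := con 1/22 :* d :+ (con 10/11 :* (con ½ :* d) :- (con ½ :* d :- x))) refl Δ (drop n))

  drop-upper : ∀ n → 2 ℕ.≤ n → drop n ≤ Δ
  drop-upper n p = lin (10/11 * (½ * Δ) - (drop n - ½ * Δ) + 1/22 * Δ)
    (0≤+ (0≤-diff (≤-trans (a≤∣a∣ (drop n - ½ * Δ)) (drop-bound n p))) (0≤* (nonNegative⁻¹ 1/22) 0≤Δ))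
    (solve 2 (λ d x → d := x :+ (con 10/11 :* (con ½ :* d) :- (x :- con ½ :* d) :+ con 1/22 :* d)) refl Δ (drop n))

bisect : (ℚ → ℚ) → ℕ → ℚ → ℚ → ℚ
bisect f zero    a b = a
bisect f (suc n) a b =
  let m = ½ * (a + b) in
  if does (0ℚ ≤? f m) then bisect f n m b else bisect f n a m

record IsBracket (f : ℚ → ℚ) (a b δ r : ℚ) : Set where
  field
    upper : ℚ
    a≤r   : a ≤ r
    r≤u   : r ≤ upper
    u≤b   : upper ≤ b
    width : upper - r ≡ δ
    0≤fr  : 0ℚ ≤ f r
    fu≤0  : f upper ≤ 0ℚ

bisect-bracket : ∀ f n a b → a ≤ b → 0ℚ ≤ f a → f b ≤ 0ℚ →
                 IsBracket f a b (½ ^ n * (b - a)) (bisect f n a b)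
bisect-bracket f zero a b a≤b 0≤fa fb≤0 = record
  { upper = b ; a≤r = ≤-refl ; r≤u = a≤b ; u≤b = ≤-refl
  ; width = sym (*-identityˡ (b - a)) ; 0≤fr = 0≤fa ; fu≤0 = fb≤0 }
bisect-bracket f (suc n) a b a≤b 0≤fa fb≤0 = go (0ℚ ≤? f m)
  where
  m : ℚ
  m = ½ * (a + b)
  0≤½[b-a] : 0ℚ ≤ ½ * (b - a)
  0≤½[b-a] = 0≤* (nonNegative⁻¹ ½) (0≤-diff a≤b)
  a≤m : a ≤ m
  a≤m = lin (½ * (b - a)) 0≤½[b-a] (solve 2 (λ a b → con ½ :* (a :+ b) := a :+ con ½ :* (b :- a)) refl a b)
  m≤b : m ≤ b
  m≤b = lin (½ * (b - a)) 0≤½[b-a] (solve 2 (λ a b → b := con ½ :* (a :+ b) :+ con ½ :* (b :- a)) refl a b)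
  go : (d : Dec (0ℚ ≤ f m)) →
       IsBracket f a b (½ ^ suc n * (b - a)) (if does d then bisect f n m b else bisect f n a m)
  go (yes 0≤fm) = record
    { upper = upper ; a≤r = ≤-trans a≤m a≤r ; r≤u = r≤u ; u≤b = u≤b
    ; width = trans width (solve 3 (λ h a b → h :* (b :- con ½ :* (a :+ b)) := con ½ :* h :* (b :- a)) refl (½ ^ n) a b)
    ; 0≤fr = 0≤fr ; fu≤0 = fu≤0 }
    where open IsBracket (bisect-bracket f n m b m≤b 0≤fm fb≤0)
  go (no 0≰fm) = record
    { upper = upper ; a≤r = a≤r ; r≤u = r≤u ; u≤b = ≤-trans u≤b m≤b
    ; width = trans width (solve 3 (λ h a b → h :* (con ½ :* (a :+ b) :- a) := con ½ :* h :* (b :- a)) refl (½ ^ n) a b)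
    ; 0≤fr = 0≤fr ; fu≤0 = fu≤0 }
    where open IsBracket (bisect-bracket f n a m a≤m 0≤fa (<⇒≤ (≰⇒> 0≰fm)))

-- π / 2 is approximated by locating a zero of the n-th partial sum of the
-- cosine series in [1, 2] by n bisections.
halfπ-approx : ℕ → ℚ
halfπ-approx n = bisect (cosSum n) n 1ℚ 2ℚ

dom-halves-from-3 : ∀ k → 3 ℕ.≤ k → dom 2ℚ (suc k) ≤ ½ * dom 2ℚ k
dom-halves-from-3 k p = dom-halves 2ℚ k
  (≤-trans (*-monoʳ {2ℚ * 2ℚ} (nonNegative⁻¹ (2ℚ * 2ℚ)) (ratio-anti p)) (from-yes (2ℚ * 2ℚ * ratio 3 ≤? ½)))

cosSum[1]≥0 : ∀ n → 3 ℕ.≤ n → 0ℚ ≤ cosSum n 1ℚ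
cosSum[1]≥0 n p = ≤-trans (from-yes (0ℚ ≤? cosSum 3 1ℚ - 2ℚ * dom 2ℚ 3))
  (lin (2ℚ * dom 2ℚ 3 - (cosSum 3 1ℚ - cosSum n 1ℚ))
    (0≤-diff (≤-trans (a≤∣a∣ (cosSum 3 1ℚ - cosSum n 1ℚ))
      (subst (_≤ 2ℚ * dom 2ℚ 3) (∣-∣-swap (cosSum n 1ℚ) (cosSum 3 1ℚ))
        (cosSum-tail 2ℚ 3 dom-halves-from-3 1ℚ (from-yes (1ℚ ≤? 2ℚ)) n p))))
    (solve 3 (λ x y d → y := (x :- d) :+ (d :- (x :- y))) refl (cosSum 3 1ℚ) (cosSum n 1ℚ) (2ℚ * dom 2ℚ 3)))

cosSum[2]≤0 : ∀ n → 3 ℕ.≤ n → cosSum n 2ℚ ≤ 0ℚ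
cosSum[2]≤0 n p = ≤-trans
  (lin (2ℚ * dom 2ℚ 3 - (cosSum n 2ℚ - cosSum 3 2ℚ))
    (0≤-diff (≤-trans (a≤∣a∣ (cosSum n 2ℚ - cosSum 3 2ℚ))
      (cosSum-tail 2ℚ 3 dom-halves-from-3 2ℚ ≤-refl n p)))
    (solve 3 (λ x y d → x :+ d := y :+ (d :- (y :- x))) refl (cosSum 3 2ℚ) (cosSum n 2ℚ) (2ℚ * dom 2ℚ 3)))
  (from-yes (cosSum 3 2ℚ + 2ℚ * dom 2ℚ 3 ≤? 0ℚ))

4ℚ 11ℚ 33ℚ : ℚ
4ℚ  = + 4 / 1
11ℚ = + 11 / 1
33ℚ = + 33 / 1

record IsApproxZero (n : ℕ) (r : ℚ) : Set where
  field
    1≤r   : 1ℚ ≤ r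
    r≤2   : r ≤ 2ℚ
    0≤cos : 0ℚ ≤ cosSum n r
    cos≤  : cosSum n r ≤ 4ℚ * ½ ^ n

halfπ-approx-spec : ∀ n → 3 ℕ.≤ n → IsApproxZero n (halfπ-approx n)
halfπ-approx-spec n 3≤n = record
  { 1≤r = a≤r ; r≤2 = ≤-trans r≤u u≤b ; 0≤cos = 0≤fr ; cos≤ = small }
  where
  open IsBracket (bisect-bracket (cosSum n) n 1ℚ 2ℚ (from-yes (1ℚ ≤? 2ℚ)) (cosSum[1]≥0 n 3≤n) (cosSum[2]≤0 n 3≤n))
  r : ℚ
  r = halfπ-approx n
  open Decrease r upper (≤-trans (nonNegative⁻¹ 1ℚ) a≤r) r≤u u≤b using (drop-upper)
  open ≤-Reasoning
  small : cosSum n r ≤ 4ℚ * ½ ^ n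
  small = begin
    cosSum n r                                  ≤⟨ lin (- cosSum n upper) (neg-antimono-≤ fu≤0) refl ⟩
    cosSum n r - cosSum n upper                 ≤⟨ drop-upper n (ℕ.≤-trans (ℕ.n≤1+n 2) 3≤n) ⟩
    upper * upper - r * r                       ≡⟨ solve 2 (λ u r → u :* u :- r :* r := (u :- r) :* (u :+ r)) refl upper r ⟩
    (upper - r) * (upper + r)                   ≤⟨ *-monoʳ (0≤-diff r≤u) (+-mono-≤ u≤b (≤-trans r≤u u≤b)) ⟩
    (upper - r) * 4ℚ                            ≡⟨ cong (_* 4ℚ) width ⟩
    ½ ^ n * (2ℚ - 1ℚ) * 4ℚ                      ≡⟨ solve 1 (λ h → h :* (con 2ℚ :- con 1ℚ) :* con 4ℚ := con 4ℚ :* h) refl (½ ^ n) ⟩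
    4ℚ * ½ ^ n                                  ∎

½^-bound : ∀ n → ι (suc n) * ½ ^ n ≤ 1ℚ
½^-bound zero    = ≤-refl
½^-bound (suc n) = ≤-trans
  (lin (½ * ((ι (suc n) - 1ℚ) * ½ ^ n))
    (0≤* (nonNegative⁻¹ ½) (0≤* (0≤-diff (ι-mono {1} {suc n} (ℕ.s≤s ℕ.z≤n))) (0≤^ (nonNegative⁻¹ ½) n)))
    (subst (λ z → ι (suc n) * ½ ^ n ≡ z * (½ * ½ ^ n) + ½ * ((ι (suc n) - 1ℚ) * ½ ^ n)) (sym (ι-suc (suc n)))
      (solve 2 (λ i d → i :* d := (con 1ℚ :+ i) :* (con ½ :* d) :+ con ½ :* ((i :- con 1ℚ) :* d)) refl (ι (suc n)) (½ ^ n))))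
  (½^-bound n)

4*½^-vanishes : ∀ ε → 0ℚ < ε → ∃ λ N → ∀ n → N ℕ.≤ n → 4ℚ * ½ ^ n ≤ ε
4*½^-vanishes ε 0<ε = N , bound
  where
  N : ℕ
  N = proj₁ (archimedean (4ℚ * recip ε 0<ε))
  bound : ∀ n → N ℕ.≤ n → 4ℚ * ½ ^ n ≤ ε
  bound n N≤n = begin
    4ℚ * ½ ^ n                          ≡⟨ *-identityʳ (4ℚ * ½ ^ n) ⟨
    4ℚ * ½ ^ n * 1ℚ                     ≡⟨ cong (4ℚ * ½ ^ n *_) (*-recip ε 0<ε) ⟨
    4ℚ * ½ ^ n * (ε * recip ε 0<ε)      ≡⟨ solve 3 (λ h e r → con 4ℚ :* h :* (e :* r) := e :* (con 4ℚ :* r :* h)) refl (½ ^ n) ε (recip ε 0<ε) ⟩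
    ε * (4ℚ * recip ε 0<ε * ½ ^ n)      ≤⟨ *-monoʳ (<⇒≤ 0<ε) (*-monoʳ-≤-nonNeg (½ ^ n) {{nonNegative (0≤^ (nonNegative⁻¹ ½) n)}}
                                            (≤-trans (proj₂ (archimedean (4ℚ * recip ε 0<ε))) (ι-mono (ℕ.≤-trans N≤n (ℕ.n≤1+n n))))) ⟩
    ε * (ι (suc n) * ½ ^ n)             ≤⟨ *-monoʳ (<⇒≤ 0<ε) (½^-bound n) ⟩
    ε * 1ℚ                              ≡⟨ *-identityʳ ε ⟩
    ε                                   ∎
    where open ≤-Reasoning

cosSum-separates-≤ : ∀ n → 2 ℕ.≤ n → ∀ x y → 1ℚ ≤ x → x ≤ y → y ≤ 2ℚ →
                     ∣ x - y ∣ ≤ 11ℚ * ∣ cosSum n x - cosSum n y ∣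
cosSum-separates-≤ n 2≤n x y 1≤x x≤y y≤2 = begin
  ∣ x - y ∣                             ≡⟨ trans (∣-∣-swap x y) (0≤p⇒∣p∣≡p (0≤-diff x≤y)) ⟩
  y - x                                 ≤⟨ lin (½ * ((y - x) * ((x - 1ℚ) + (y - 1ℚ))))
                                            (0≤* (nonNegative⁻¹ ½) (0≤* (0≤-diff x≤y) (0≤+ (0≤-diff 1≤x) (0≤-diff (≤-trans 1≤x x≤y)))))
                                            (solve 2 (λ x y → con 11ℚ :* (con 1/22 :* (y :* y :- x :* x)) :=
                                               (y :- x) :+ con ½ :* ((y :- x) :* ((x :- con 1ℚ) :+ (y :- con 1ℚ)))) refl x y) ⟩
  11ℚ * (1/22 * (y * y - x * x))        ≤⟨ *-monoʳ {11ℚ} (nonNegative⁻¹ 11ℚ) (drop-lower n 2≤n) ⟩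
  11ℚ * (cosSum n x - cosSum n y)       ≤⟨ *-monoʳ {11ℚ} (nonNegative⁻¹ 11ℚ) (a≤∣a∣ (cosSum n x - cosSum n y)) ⟩
  11ℚ * ∣ cosSum n x - cosSum n y ∣     ∎
  where
  open ≤-Reasoning
  open Decrease x y (≤-trans (nonNegative⁻¹ 1ℚ) 1≤x) x≤y y≤2 using (drop-lower)

cosSum-separates : ∀ n → 2 ℕ.≤ n → ∀ x y → 1ℚ ≤ x → x ≤ 2ℚ → 1ℚ ≤ y → y ≤ 2ℚ →
                   ∣ x - y ∣ ≤ 11ℚ * ∣ cosSum n x - cosSum n y ∣
cosSum-separates n p x y 1≤x x≤2 1≤y y≤2 with ≤-total x y
... | inj₁ x≤y = cosSum-separates-≤ n p x y 1≤x x≤y y≤2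
... | inj₂ y≤x = subst₂ (λ u v → u ≤ 11ℚ * v) (∣-∣-swap y x) (∣-∣-swap (cosSum n y) (cosSum n x))
                   (cosSum-separates-≤ n p y x 1≤y y≤x x≤2)

∣-∣≤-unit : ∀ {a b ε} → 0ℚ ≤ a → a ≤ ε → 0ℚ ≤ b → b ≤ ε → ∣ a - b ∣ ≤ ε
∣-∣≤-unit {a} {b} {ε} 0≤a a≤ε 0≤b b≤ε = ∣∣≤
  (lin ((ε - b) + a) (0≤+ (0≤-diff b≤ε) 0≤a) (solve 3 (λ a b e → a :- b := :- e :+ ((e :- b) :+ a)) refl a b ε))
  (lin ((ε - a) + b) (0≤+ (0≤-diff a≤ε) 0≤b) (solve 3 (λ a b e → e := (a :- b) :+ ((e :- a) :+ b)) refl a b ε))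

cauchy-halfπ : IsCauchy halfπ-approx
cauchy-halfπ = cauchy-by 33ℚ (positive⁻¹ 33ℚ) λ ε 0<ε →
  let K , hK = cosSum-uniform 2ℚ ε 0<ε
      L , hL = 4*½^-vanishes ε 0<ε
      T = K ℕ.⊔ L
  in 3 ℕ.⊔ T , λ m n p q → close ε K L hK hL m n
       (ℕ.m⊔n≤o⇒m≤o 3 T p) (ℕ.m⊔n≤o⇒m≤o 3 T q)
       (ℕ.m⊔n≤o⇒m≤o K L (ℕ.m⊔n≤o⇒n≤o 3 T p)) (ℕ.m⊔n≤o⇒m≤o K L (ℕ.m⊔n≤o⇒n≤o 3 T q))
       (ℕ.m⊔n≤o⇒n≤o K L (ℕ.m⊔n≤o⇒n≤o 3 T p)) (ℕ.m⊔n≤o⇒n≤o K L (ℕ.m⊔n≤o⇒n≤o 3 T q))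
  where
  close : ∀ ε K L →
    (∀ q → ∣ q ∣ ≤ 2ℚ → ∀ n → K ℕ.≤ n → ∣ cosSum n q - cosSum K q ∣ ≤ ε) →
    (∀ n → L ℕ.≤ n → 4ℚ * ½ ^ n ≤ ε) →
    ∀ m n → 3 ℕ.≤ m → 3 ℕ.≤ n → K ℕ.≤ m → K ℕ.≤ n → L ℕ.≤ m → L ℕ.≤ n →
    ∣ halfπ-approx m - halfπ-approx n ∣ ≤ 33ℚ * ε
  close ε K L hK hL m n 3≤m 3≤n K≤m K≤n L≤m L≤n = begin
    ∣ x - y ∣                                       ≤⟨ cosSum-separates n (ℕ.≤-trans (ℕ.n≤1+n 2) 3≤n) x y X.1≤r X.r≤2 Y.1≤r Y.r≤2 ⟩
    11ℚ * ∣ cosSum n x - cosSum n y ∣               ≤⟨ *-monoʳ {11ℚ} (nonNegative⁻¹ 11ℚ) chain ⟩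
    11ℚ * (ε + (ε + ε))                             ≡⟨ solve 1 (λ e → con 11ℚ :* (e :+ (e :+ e)) := con 33ℚ :* e) refl ε ⟩
    33ℚ * ε                                         ∎
    where
    open ≤-Reasoning
    module X = IsApproxZero (halfπ-approx-spec m 3≤m)
    module Y = IsApproxZero (halfπ-approx-spec n 3≤n)
    x = halfπ-approx m
    y = halfπ-approx n
    ∣x∣≤2 : ∣ x ∣ ≤ 2ℚ
    ∣x∣≤2 = subst (_≤ 2ℚ) (sym (0≤p⇒∣p∣≡p (≤-trans (nonNegative⁻¹ 1ℚ) X.1≤r))) X.r≤2
    chain : ∣ cosSum n x - cosSum n y ∣ ≤ ε + (ε + ε)
    chain = ≤-trans (∣-∣-triangle (cosSum n x) (cosSum K x) (cosSum n y))
      (+-mono-≤ (hK x ∣x∣≤2 n K≤n)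
        (≤-trans (∣-∣-triangle (cosSum K x) (cosSum m x) (cosSum n y))
          (+-mono-≤ (subst (_≤ ε) (∣-∣-swap (cosSum m x) (cosSum K x)) (hK x ∣x∣≤2 m K≤m))
            (∣-∣≤-unit X.0≤cos (≤-trans X.cos≤ (hL m L≤m)) Y.0≤cos (≤-trans Y.cos≤ (hL n L≤n))))))

halfπ : ℝ
halfπ = mkℝ halfπ-approx cauchy-halfπ

π : ℝ
π = fromℚ 2ℚ *ᵣ halfπ

-- The following three facts determine π: its half is the least positive
-- zero of the cosine.

0<halfπ : fromℚ 0ℚ <ᵣ halfπ
0<halfπ = mk< 1ℚ (positive⁻¹ 1ℚ) (3 , λ n 3≤n →
  ≤-respʳ (sym (+-identityʳ (halfπ-approx n))) (IsApproxZero.1≤r (halfπ-approx-spec n 3≤n)))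

cos-halfπ : cos halfπ ≈ᵣ fromℚ 0ℚ
cos-halfπ = mk≈ λ ε 0<ε →
  let L , hL = 4*½^-vanishes (½ * ε) (0<* (positive⁻¹ ½) 0<ε)
  in 3 ℕ.⊔ L , λ n p →
  let module X = IsApproxZero (halfπ-approx-spec n (ℕ.m⊔n≤o⇒m≤o 3 L p))
      c = cosSum n (halfπ-approx n)
  in ≤-<-trans
    (≤-trans (≤-reflexive (trans (cong ∣_∣ (+-identityʳ c)) (0≤p⇒∣p∣≡p X.0≤cos)))
      (≤-trans X.cos≤ (hL n (ℕ.m⊔n≤o⇒n≤o 3 L p))))
    (subst₂ _<_ (+-identityʳ (½ * ε)) (solve 1 (λ e → con ½ :* e :+ con ½ :* e := e) refl ε)
      (+-monoʳ-< (½ * ε) (0<* (positive⁻¹ ½) 0<ε)))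

cosSum-∣∣ : ∀ n q → cosSum n ∣ q ∣ ≡ cosSum n q
cosSum-∣∣ zero    q = refl
cosSum-∣∣ (suc n) q = cong₂ _+_ (cosSum-∣∣ n q)
  (cong (λ z → (- 1ℚ) ^ n * z * invFact n)
    (trans (^-double ∣ q ∣ n) (trans (cong (_^ n) (∣a∣² q)) (sym (^-double q n)))))

cos-positive : ∀ x → -ᵣ halfπ <ᵣ x → x <ᵣ halfπ → fromℚ 0ℚ <ᵣ cos x
cos-positive x (mk< δ₁ 0<δ₁ (M , hM)) (mk< δ₂ 0<δ₂ (N , hN)) =
  mk< (1/22 * δ) (0<* (positive⁻¹ 1/22) (proj₁ (proj₂ min))) (3 ℕ.⊔ (M ℕ.⊔ N) , λ n p →
    ≤-respʳ (sym (+-identityʳ (cosSum n (seq x n))))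
      (bound n (ℕ.m⊔n≤o⇒m≤o 3 (M ℕ.⊔ N) p)
        (hM n (ℕ.m⊔n≤o⇒m≤o M N (ℕ.m⊔n≤o⇒n≤o 3 (M ℕ.⊔ N) p)))
        (hN n (ℕ.m⊔n≤o⇒n≤o M N (ℕ.m⊔n≤o⇒n≤o 3 (M ℕ.⊔ N) p)))))
  where
  min : ∃ λ δ → 0ℚ < δ × δ ≤ δ₁ × δ ≤ δ₂
  min with ≤-total δ₁ δ₂
  ... | inj₁ p = δ₁ , 0<δ₁ , ≤-refl , p
  ... | inj₂ p = δ₂ , 0<δ₂ , p , ≤-refl
  δ : ℚ
  δ = proj₁ min
  bound : ∀ n → 3 ℕ.≤ n → δ₁ ≤ seq x n - (- halfπ-approx n) → δ₂ ≤ halfπ-approx n - seq x n →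
          1/22 * δ ≤ cosSum n (seq x n)
  bound n 3≤n p₁ p₂ = begin
    1/22 * δ                          ≤⟨ *-monoʳ {1/22} (nonNegative⁻¹ 1/22) δ≤Δ ⟩
    1/22 * (h * h - a * a)            ≤⟨ drop-lower n (ℕ.≤-trans (ℕ.n≤1+n 2) 3≤n) ⟩
    cosSum n a - cosSum n h           ≤⟨ lin (cosSum n h) X.0≤cos (solve 2 (λ a b → a := (a :- b) :+ b) refl (cosSum n a) (cosSum n h)) ⟩
    cosSum n a                        ≡⟨ cosSum-∣∣ n q ⟩
    cosSum n q                        ∎
    where
    open ≤-Reasoning
    module X = IsApproxZero (halfπ-approx-spec n 3≤n)
    h = halfπ-approx n
    q = seq x n
    a = ∣ q ∣
    a≤h-δ : a ≤ h - δ
    a≤h-δ = ∣∣≤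
      (lin (q - (- h) - δ) (0≤-diff (≤-trans (proj₁ (proj₂ (proj₂ min))) p₁))
        (solve 3 (λ q h d → q := :- (h :- d) :+ (q :- (:- h) :- d)) refl q h δ))
      (lin (h - q - δ) (0≤-diff (≤-trans (proj₂ (proj₂ (proj₂ min))) p₂))
        (solve 3 (λ q h d → h :- d := q :+ (h :- q :- d)) refl q h δ))
    0≤h-a-δ : 0ℚ ≤ h - δ - a
    0≤h-a-δ = 0≤-diff a≤h-δ
    0≤δ : 0ℚ ≤ δ
    0≤δ = <⇒≤ (proj₁ (proj₂ min))
    a≤h : a ≤ h
    a≤h = ≤-trans a≤h-δ (lin δ 0≤δ (solve 2 (λ h d → h := (h :- d) :+ d) refl h δ))
    δ≤Δ : δ ≤ h * h - a * a
    δ≤Δ = lin (δ * ((h - 1ℚ) + a) + (h - δ - a) * (h + a))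
      (0≤+ (0≤* 0≤δ (0≤+ (0≤-diff X.1≤r) (0≤∣p∣ q)))
        (0≤* 0≤h-a-δ (0≤+ (≤-trans (nonNegative⁻¹ 1ℚ) X.1≤r) (0≤∣p∣ q))))
      (solve 3 (λ h a d → h :* h :- a :* a := d :+ (d :* ((h :- con 1ℚ) :+ a) :+ (h :- d :- a) :* (h :+ a))) refl h a δ)
    open Decrease a h (0≤∣p∣ q) a≤h X.r≤2 using (drop-lower)

α β γ : ℝ
α = fromℚ 2ℚ *ᵣ cos (fromℚ (+ 2 / 7) *ᵣ π)
β = fromℚ 2ℚ *ᵣ cos (fromℚ (+ 4 / 7) *ᵣ π)
γ = fromℚ 2ℚ *ᵣ cos (fromℚ (+ 8 / 7) *ᵣ π)

A₂ : ℕ → ℝ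
A₂ n = α ^ᵣ (2 ℕ.* n) +ᵣ β ^ᵣ (2 ℕ.* n) +ᵣ γ ^ᵣ (2 ℕ.* n)

{-# OPTIONS --safe #-}

-- The trace of J^l counts closed walks of length l, so Cayley–Hamilton for the
-- adjacency operator J of P₆ gives the recurrence.  On the trigonometric side,
-- the Cauchy product of the cosine series yields
-- 2 cos x cos y = cos (x + y) + cos (x - y).  With C = cos (π / 14) > 0 and
-- a = 2 cos (π / 7), repeated use of this formula turns cos (π / 2) = 0 into
-- C (a³ - a² - 2a + 1) = 0, so a is a root of the cubic factor.  Modulo that
-- relation α = a² - 2, β = 1 + a - a² and γ = - a, and everything else is
-- polynomial algebra in a.

module Submission where

open import Algebra.Bundles using (CommutativeRing)
open import Algebra.Core using (Op₁; Op₂)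
import Algebra.Properties.CommutativeSemiring.Exp as CommutativeSemiringExp
import Algebra.Solver.Ring as RingSolver
open import Algebra.Solver.Ring.AlmostCommutativeRing using (fromCommutativeRing; _-Raw-AlmostCommutative⟶_)
open import Algebra.Structures using (IsCommutativeRing)
open import Data.Bool.Base using (Bool; true; false; if_then_else_; _∧_)
open import Data.Bool.Properties using (∧-assoc)
open import Data.Fin.Base using (Fin)
open import Data.Fin.Patterns using (0F; 1F; 2F; 3F; 4F; 5F)
import Data.Fin.Properties as Fin
open import Data.Integer.Base as ℤ using (+_)
import Data.Integer.Properties as ℤ
open import Data.List.Base as List using (List; []; _∷_; allFin; cartesianProductWith; filter; length)
import Data.List.Properties as List
open import Data.Maybe.Base using (Maybe; just; nothing)
open import Data.Nat.Base as ℕ using (ℕ; zero; suc; _!)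
open import Data.Nat.ListAction using (sum)
import Data.Nat.Properties as ℕ
open import Data.Nat.Solver using () renaming (module +-*-Solver to ℕSolver)
open import Data.Product using (∃; _×_; _,_; proj₁; proj₂)
open import Data.Rational.Base hiding (truncate)
open import Data.Rational.Properties
open import Data.Rational.Solver using (module +-*-Solver)
import Data.Rational.Unnormalised.Base as ℚᵘ
import Data.Rational.Unnormalised.Properties as ℚᵘ
open import Data.Vec.Base as Vec using (Vec)
open import Data.Vec.Relation.Unary.Linked using (linked?)
open import Function.Base using (_∘_)
open import Level using (0ℓ)
open import Relation.Binary.Core using (Rel)
open import Relation.Binary.PropositionalEquality using (_≡_; refl; sym; trans; cong; cong₂; subst; subst₂; module ≡-Reasoning)
import Relation.Binary.Reasoning.Setoid as SetoidReasoning
open import Relation.Nullary.Decidable using (does; yes; no)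
open import Relation.Unary using (Pred; Decidable)
open import Defs
open ℚ-Exp using (_^_)

-- The angle π / 14 is chosen because 7 · π / 14 = π / 2 is the one point where the cosine vanishes
-- by construction, and cos (7θ) is divisible by cos θ. Real numbers here form a ring with no
-- general cancellation, so removing the factor C takes an effective lower bound for it; this is
-- where `cos-positive` enters. A cosine is the diagonal sequence `cosSum n (seq x n)`: argument and
-- truncation move together. The product formula is exact for the coefficients of the series, but a
-- product of two partial sums differs from the partial sum of the Cauchy product by a corner of
-- cross terms. The analytic work is to bound that corner geometrically in `n` and uniformly over
-- bounded arguments. Every angle that occurs is reached through the product formula, so symmetries
-- such as cos (π - x) = - cos x turn into equalities of residues modulo the cubic relation. This
-- algebra takes place in an abstract commutative ring that knows the cosine only through the
-- product formula, two values and one cancellation law.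

module ℚ-CExp = CommutativeSemiringExp (CommutativeRing.commutativeSemiring +-*-commutativeRing)

-- The algebra of 2 cos (π / 7)

module Heptagon
  {X : Set} (eq : Rel X 0ℓ) (add mul : Op₂ X) (neg : Op₁ X) (pow : X → ℕ → X) (⟦_⟧ : ℚ → X)
  (isCommutativeRing : IsCommutativeRing eq add mul neg ⟦ 0ℚ ⟧ ⟦ 1ℚ ⟧)
  (+-homo : ∀ p q → eq ⟦ p + q ⟧ (add ⟦ p ⟧ ⟦ q ⟧))
  (*-homo : ∀ p q → eq ⟦ p * q ⟧ (mul ⟦ p ⟧ ⟦ q ⟧))
  (-‿homo : ∀ p → eq ⟦ - p ⟧ (neg ⟦ p ⟧))
  (^-zero : ∀ x → eq (pow x 0) ⟦ 1ℚ ⟧)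
  (^-suc : ∀ x k → eq (pow x (suc k)) (mul x (pow x k)))
  -- D q stands for 2 cos (q π / 2).
  (D : ℚ → X)
  (D-product : ∀ p q → eq (mul (D p) (D q)) (add (D (p + q)) (D (p - q))))
  (D-zero : eq (D 0ℚ) ⟦ 2ℚ ⟧)
  (D-one : eq (D 1ℚ) ⟦ 0ℚ ⟧)
  (D-cancel : ∀ y → eq (mul (D (+ 1 / 7)) y) ⟦ 0ℚ ⟧ → eq y ⟦ 0ℚ ⟧)
  where

  infix  4 _≈_
  infixl 6 _⊞_ _⊟_
  infixl 7 _⊠_
  infix  8 ⊝_
  infixr 8 _↑_

  _≈_ : Rel X 0ℓ
  _≈_ = eq

  _⊞_ _⊠_ _⊟_ : Op₂ X
  _⊞_ = add
  _⊠_ = mul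
  x ⊟ y = add x (neg y)

  ⊝_ : Op₁ X
  ⊝_ = neg

  _↑_ : X → ℕ → X
  _↑_ = pow

  R : CommutativeRing 0ℓ 0ℓ
  R = record { isCommutativeRing = isCommutativeRing }

  open CommutativeRing R using (setoid)
    renaming (+-cong to ⊞-cong; *-cong to ⊠-cong; -‿cong to ⊝-cong; refl to ≈-refl; sym to ≈-sym; trans to ≈-trans)

  ⟦⟧-≟ : ∀ p q → Maybe (⟦ p ⟧ ≈ ⟦ q ⟧)
  ⟦⟧-≟ p q with p ≟ q
  ... | yes refl = just ≈-refl
  ... | no _     = nothing

  ⟦⟧-morphism : CommutativeRing.rawRing +-*-commutativeRing -Raw-AlmostCommutative⟶ fromCommutativeRing R
  ⟦⟧-morphism = record
    { ⟦_⟧ = ⟦_⟧ ; +-homo = +-homo ; *-homo = *-homo ; -‿homo = -‿homo ; 0-homo = ≈-refl ; 1-homo = ≈-refl }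

  open RingSolver (CommutativeRing.rawRing +-*-commutativeRing) (fromCommutativeRing R) ⟦⟧-morphism ⟦⟧-≟
    using (Polynomial; solve; con; _:+_; _:*_; :-_; _:-_; _:=_)

  open SetoidReasoning setoid

  -- Calculation modulo the relation `p`: in each use `q` is the quotient of a polynomial division,
  -- and the ring solver confirms the division with remainder.
  ≈-mod : ∀ {p} → p ≈ ⟦ 0ℚ ⟧ → ∀ {x y} q → x ≈ y ⊞ p ⊠ q → x ≈ y
  ≈-mod {p} p≈0 {x} {y} q e = begin
    x                       ≈⟨ e ⟩
    y ⊞ p ⊠ q               ≈⟨ ⊞-cong ≈-refl (⊠-cong p≈0 ≈-refl) ⟩
    y ⊞ ⟦ 0ℚ ⟧ ⊠ q          ≈⟨ solve 2 (λ y q → y :+ con 0ℚ :* q := y) ≈-refl y q ⟩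
    y                       ∎

  -- For fixed `q` this is the three-term Chebyshev recurrence. Steps of 2/7 lead from 1/7 through
  -- 3/7 and 5/7 to 1, where `D` vanishes.
  D-next : ∀ p q {r s} → p + q ≡ r → p - q ≡ s → D r ≈ D p ⊠ D q ⊟ D s
  D-next p q {r} {s} refl refl = begin
    D r                     ≈⟨ solve 2 (λ x y → x := x :+ y :- y) ≈-refl (D r) (D s) ⟩
    D r ⊞ D s ⊟ D s         ≈⟨ ⊞-cong (D-product p q) ≈-refl ⟨
    D p ⊠ D q ⊟ D s         ∎

  D-double : ∀ p {q} → p + p ≡ q → D q ≈ D p ⊠ D p ⊟ ⟦ 2ℚ ⟧
  D-double p e = ≈-trans (D-next p p e (+-inverseʳ p)) (⊞-cong ≈-refl (⊝-cong D-zero))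

  a : X
  a = D (+ 2 / 7)

  -- The minimal polynomials of 2 cos (π / 7) and of 2 cos (2π / 7). The trailing factors `⟦ 1ℚ ⟧`
  -- in `cubic` reproduce the unfolding of the powers `x ^ᵣ 3` and `x ^ᵣ 2` of the theorem.
  minPoly cubic : X → X
  minPoly x = x ⊠ x ⊠ x ⊟ x ⊠ x ⊟ ⟦ 2ℚ ⟧ ⊠ x ⊞ ⟦ 1ℚ ⟧
  cubic x = x ⊠ (x ⊠ (x ⊠ ⟦ 1ℚ ⟧)) ⊞ x ⊠ (x ⊠ ⟦ 1ℚ ⟧) ⊟ ⟦ + 2 / 1 ⟧ ⊠ x ⊟ ⟦ + 1 / 1 ⟧

  ⟨minPoly⟩ ⟨cubic⟩ : ∀ {n} → Polynomial n → Polynomial n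
  ⟨minPoly⟩ x = x :* x :* x :- x :* x :- con 2ℚ :* x :+ con 1ℚ
  ⟨cubic⟩ x = x :* (x :* (x :* con 1ℚ)) :+ x :* (x :* con 1ℚ) :- con (+ 2 / 1) :* x :- con (+ 1 / 1)

  -- cos (7θ) / cos θ is this polynomial in 2 cos (2θ); here θ = π / 14.
  minPoly-a : minPoly a ≈ ⟦ 0ℚ ⟧
  minPoly-a = D-cancel (minPoly a) (begin
    d₁ ⊠ minPoly a
      ≈⟨ solve 2 (λ d a → d :* ⟨minPoly⟩ a := ((a :* d :- d) :* a :- d) :* a :- (a :* d :- d)) ≈-refl d₁ a ⟩
    ((a ⊠ d₁ ⊟ d₁) ⊠ a ⊟ d₁) ⊠ a ⊟ (a ⊠ d₁ ⊟ d₁)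
      ≈⟨ ⊞-cong (⊠-cong (⊞-cong (⊠-cong d₃ ≈-refl) ≈-refl) ≈-refl) (⊝-cong d₃) ⟨
    (D (+ 3 / 7) ⊠ a ⊟ d₁) ⊠ a ⊟ D (+ 3 / 7)
      ≈⟨ ⊞-cong (⊠-cong (D-next (+ 3 / 7) (+ 2 / 7) refl refl) ≈-refl) ≈-refl ⟨
    D (+ 5 / 7) ⊠ a ⊟ D (+ 3 / 7)
      ≈⟨ D-next (+ 5 / 7) (+ 2 / 7) refl refl ⟨
    D 1ℚ            ≈⟨ D-one ⟩
    ⟦ 0ℚ ⟧          ∎)
    where
    d₁ : X
    d₁ = D (+ 1 / 7)
    d₃ : D (+ 3 / 7) ≈ a ⊠ d₁ ⊟ d₁
    d₃ = D-next (+ 2 / 7) (+ 1 / 7) refl refl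

  u v : X
  u = a ⊠ a ⊟ ⟦ 2ℚ ⟧
  v = ⟦ 1ℚ ⟧ ⊞ a ⊟ a ⊠ a

  ⟨u⟩ ⟨v⟩ : ∀ {n} → Polynomial n → Polynomial n
  ⟨u⟩ a = a :* a :- con 2ℚ
  ⟨v⟩ a = con 1ℚ :+ a :- a :* a

  D[4/7] : D (+ 4 / 7) ≈ u
  D[4/7] = D-double (+ 2 / 7) refl

  -- The symmetry 3π / 7 = π - 4π / 7 seen modulo `minPoly a`: the residue is the negative of that
  -- of 2 cos (4π / 7). In the same way 8π / 7 = π + π / 7 becomes `D[16/7]`.
  D[6/7] : D (+ 6 / 7) ≈ ⊝ v
  D[6/7] = ≈-trans (D-next (+ 4 / 7) (+ 2 / 7) refl refl) (≈-trans (⊞-cong (⊠-cong D[4/7] ≈-refl) ≈-refl)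
    (≈-mod minPoly-a ⟦ 1ℚ ⟧ (solve 1 (λ a → ⟨u⟩ a :* a :- a := :- ⟨v⟩ a :+ ⟨minPoly⟩ a :* con 1ℚ) ≈-refl a)))

  D[8/7] : D (+ 8 / 7) ≈ v
  D[8/7] = ≈-trans (D-double (+ 4 / 7) refl) (≈-trans (⊞-cong (⊠-cong D[4/7] D[4/7]) ≈-refl)
    (≈-mod minPoly-a (a ⊞ ⟦ 1ℚ ⟧)
      (solve 1 (λ a → ⟨u⟩ a :* ⟨u⟩ a :- con 2ℚ := ⟨v⟩ a :+ ⟨minPoly⟩ a :* (a :+ con 1ℚ)) ≈-refl a)))

  D[16/7] : D (+ 16 / 7) ≈ ⊝ a
  D[16/7] = ≈-trans (D-double (+ 8 / 7) refl) (≈-trans (⊞-cong (⊠-cong D[8/7] D[8/7]) ≈-refl)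
    (≈-mod minPoly-a (a ⊟ ⟦ 1ℚ ⟧)
      (solve 1 (λ a → ⟨v⟩ a :* ⟨v⟩ a :- con 2ℚ := :- a :+ ⟨minPoly⟩ a :* (a :- con 1ℚ)) ≈-refl a)))

  ^-cong : ∀ {x y} k → x ≈ y → x ↑ k ≈ y ↑ k
  ^-cong {x} {y} zero    e = ≈-trans (^-zero x) (≈-sym (^-zero y))
  ^-cong {x} {y} (suc k) e = ≈-trans (^-suc x k) (≈-trans (⊠-cong e (^-cong k e)) (≈-sym (^-suc y k)))

  ^-+2 : ∀ x k → x ↑ (2 ℕ.+ k) ≈ x ⊠ (x ⊠ x ↑ k)
  ^-+2 x k = ≈-trans (^-suc x (1 ℕ.+ k)) (⊠-cong ≈-refl (^-suc x k))

  ^-+4 : ∀ x k → x ↑ (4 ℕ.+ k) ≈ x ⊠ (x ⊠ (x ⊠ (x ⊠ x ↑ k)))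
  ^-+4 x k = ≈-trans (^-+2 x (2 ℕ.+ k)) (⊠-cong ≈-refl (⊠-cong ≈-refl (^-+2 x k)))

  ^-+6 : ∀ x k → x ↑ (6 ℕ.+ k) ≈ x ⊠ (x ⊠ (x ⊠ (x ⊠ (x ⊠ (x ⊠ x ↑ k)))))
  ^-+6 x k = ≈-trans (^-+2 x (4 ℕ.+ k)) (⊠-cong ≈-refl (⊠-cong ≈-refl (^-+4 x k)))

  ^-neg-even : ∀ x k → (⊝ x) ↑ (2 ℕ.* k) ≈ x ↑ (2 ℕ.* k)
  ^-neg-even x zero    = ≈-trans (^-zero (⊝ x)) (≈-sym (^-zero x))
  ^-neg-even x (suc k) rewrite ℕ.*-suc 2 k = begin
    (⊝ x) ↑ (2 ℕ.+ 2 ℕ.* k)             ≈⟨ ^-+2 (⊝ x) (2 ℕ.* k) ⟩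
    (⊝ x) ⊠ ((⊝ x) ⊠ (⊝ x) ↑ (2 ℕ.* k)) ≈⟨ ⊠-cong ≈-refl (⊠-cong ≈-refl (^-neg-even x k)) ⟩
    (⊝ x) ⊠ ((⊝ x) ⊠ x ↑ (2 ℕ.* k))     ≈⟨ solve 2 (λ x y → (:- x) :* ((:- x) :* y) := x :* (x :* y)) ≈-refl x (x ↑ (2 ℕ.* k)) ⟩
    x ⊠ (x ⊠ x ↑ (2 ℕ.* k))             ≈⟨ ^-+2 x (2 ℕ.* k) ⟨
    x ↑ (2 ℕ.+ 2 ℕ.* k)                 ∎

  ^-distrib-* : ∀ x y k → (x ⊠ y) ↑ k ≈ x ↑ k ⊠ y ↑ k
  ^-distrib-* x y zero = ≈-trans (^-zero (x ⊠ y)) (≈-trans (solve 0 (con 1ℚ := con 1ℚ :* con 1ℚ) ≈-refl)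
    (≈-sym (⊠-cong (^-zero x) (^-zero y))))
  ^-distrib-* x y (suc k) = begin
    (x ⊠ y) ↑ suc k                     ≈⟨ ≈-trans (^-suc (x ⊠ y) k) (⊠-cong ≈-refl (^-distrib-* x y k)) ⟩
    (x ⊠ y) ⊠ (x ↑ k ⊠ y ↑ k)           ≈⟨ solve 4 (λ x y p q → (x :* y) :* (p :* q) := (x :* p) :* (y :* q)) ≈-refl x y (x ↑ k) (y ↑ k) ⟩
    (x ⊠ x ↑ k) ⊠ (y ⊠ y ↑ k)           ≈⟨ ⊠-cong (^-suc x k) (^-suc y k) ⟨
    x ↑ suc k ⊠ y ↑ suc k               ∎

  module Roots (α β γ : X) (α≈ : α ≈ D (+ 4 / 7)) (β≈ : β ≈ D (+ 8 / 7)) (γ≈ : γ ≈ D (+ 16 / 7)) where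

    α≈u : α ≈ u
    α≈u = ≈-trans α≈ D[4/7]

    β≈v : β ≈ v
    β≈v = ≈-trans β≈ D[8/7]

    γ≈-a : γ ≈ ⊝ a
    γ≈-a = ≈-trans γ≈ D[16/7]

    -- Vieta's relations. The sum `u` + `v` - `a` is -1 identically, so only the coefficients of `x`
    -- and of 1 need the relation, with cofactors - `a` and 1 - `a`².
    factorisation : ∀ x → (x ⊟ α) ⊠ (x ⊟ β) ⊠ (x ⊟ γ) ≈ cubic x
    factorisation x = ≈-trans
      (⊠-cong (⊠-cong (⊞-cong ≈-refl (⊝-cong α≈u)) (⊞-cong ≈-refl (⊝-cong β≈v))) (⊞-cong ≈-refl (⊝-cong γ≈-a)))
      (≈-mod minPoly-a (⟦ 1ℚ ⟧ ⊟ a ⊠ a ⊟ a ⊠ x)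
        (solve 2 (λ x a → (x :- ⟨u⟩ a) :* (x :- ⟨v⟩ a) :* (x :- (:- a))
                        := ⟨cubic⟩ x :+ ⟨minPoly⟩ a :* (con 1ℚ :- a :* a :- a :* x)) ≈-refl x a))

    cubic-α : cubic α ≈ ⟦ 0ℚ ⟧
    cubic-α = ≈-trans (≈-sym (factorisation α))
      (solve 3 (λ a b c → (a :- a) :* (a :- b) :* (a :- c) := con 0ℚ) ≈-refl α β γ)

    cubic-β : cubic β ≈ ⟦ 0ℚ ⟧
    cubic-β = ≈-trans (≈-sym (factorisation β))
      (solve 3 (λ a b c → (b :- a) :* (b :- b) :* (b :- c) := con 0ℚ) ≈-refl α β γ)

    cubic-γ : cubic γ ≈ ⟦ 0ℚ ⟧
    cubic-γ = ≈-trans (≈-sym (factorisation γ))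
      (solve 3 (λ a b c → (c :- a) :* (c :- b) :* (c :- c) := con 0ℚ) ≈-refl α β γ)

    -- t⁶ - 5t⁴ + 6t² - 1 is the product of cubic t and minPoly t = - cubic (- t).
    power-step : ∀ t → cubic t ≈ ⟦ 0ℚ ⟧ → ∀ m →
      t ↑ (6 ℕ.+ m) ≈ ⟦ + 5 / 1 ⟧ ⊠ t ↑ (4 ℕ.+ m) ⊟ ⟦ + 6 / 1 ⟧ ⊠ t ↑ (2 ℕ.+ m) ⊞ t ↑ m
    power-step t e m = begin
      t ↑ (6 ℕ.+ m)                                         ≈⟨ ^-+6 t m ⟩
      t ⊠ (t ⊠ (t ⊠ (t ⊠ (t ⊠ (t ⊠ t ↑ m)))))
        ≈⟨ ≈-mod e (minPoly t ⊠ t ↑ m)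
             (solve 2 (λ t y → t :* (t :* (t :* (t :* (t :* (t :* y)))))
                := con (+ 5 / 1) :* (t :* (t :* (t :* (t :* y)))) :- con (+ 6 / 1) :* (t :* (t :* y)) :+ y
                   :+ ⟨cubic⟩ t :* (⟨minPoly⟩ t :* y)) ≈-refl t (t ↑ m)) ⟩
      ⟦ + 5 / 1 ⟧ ⊠ (t ⊠ (t ⊠ (t ⊠ (t ⊠ t ↑ m)))) ⊟ ⟦ + 6 / 1 ⟧ ⊠ (t ⊠ (t ⊠ t ↑ m)) ⊞ t ↑ m
        ≈⟨ ⊞-cong (⊞-cong (⊠-cong ≈-refl (^-+4 t m)) (⊝-cong (⊠-cong ≈-refl (^-+2 t m)))) ≈-refl ⟨
      ⟦ + 5 / 1 ⟧ ⊠ t ↑ (4 ℕ.+ m) ⊟ ⟦ + 6 / 1 ⟧ ⊠ t ↑ (2 ℕ.+ m) ⊞ t ↑ m ∎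

    powerSum : ℕ → X
    powerSum m = α ↑ m ⊞ β ↑ m ⊞ γ ↑ m

    powerSum-step : ∀ m → powerSum (6 ℕ.+ m) ≈
      ⟦ + 5 / 1 ⟧ ⊠ powerSum (4 ℕ.+ m) ⊟ ⟦ + 6 / 1 ⟧ ⊠ powerSum (2 ℕ.+ m) ⊞ powerSum m
    powerSum-step m = ≈-trans
      (⊞-cong (⊞-cong (power-step α cubic-α m) (power-step β cubic-β m)) (power-step γ cubic-γ m))
      (solve 9 (λ a₄ a₂ a₀ b₄ b₂ b₀ c₄ c₂ c₀ →
          (step a₄ a₂ a₀ :+ step b₄ b₂ b₀) :+ step c₄ c₂ c₀ := step (a₄ :+ b₄ :+ c₄) (a₂ :+ b₂ :+ c₂) (a₀ :+ b₀ :+ c₀)) ≈-refl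
        (α ↑ (4 ℕ.+ m)) (α ↑ (2 ℕ.+ m)) (α ↑ m) (β ↑ (4 ℕ.+ m)) (β ↑ (2 ℕ.+ m)) (β ↑ m) (γ ↑ (4 ℕ.+ m)) (γ ↑ (2 ℕ.+ m)) (γ ↑ m))
      where
      step : ∀ {n} → Polynomial n → Polynomial n → Polynomial n → Polynomial n
      step x y z = con (+ 5 / 1) :* x :- con (+ 6 / 1) :* y :+ z

    powerSum-0 : powerSum 0 ≈ ⟦ + 3 / 1 ⟧
    powerSum-0 = ≈-trans (⊞-cong (⊞-cong (^-zero α) (^-zero β)) (^-zero γ))
      (solve 0 (con 1ℚ :+ con 1ℚ :+ con 1ℚ := con (+ 3 / 1)) ≈-refl)

    powerSum-2 : powerSum 2 ≈ ⟦ + 5 / 1 ⟧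
    powerSum-2 = ≈-trans (⊞-cong (⊞-cong (square α≈u) (square β≈v)) (square γ≈-a))
      (≈-mod minPoly-a (⟦ 2ℚ ⟧ ⊠ a)
        (solve 1 (λ a → ⟨u⟩ a :* ⟨u⟩ a :+ ⟨v⟩ a :* ⟨v⟩ a :+ (:- a) :* (:- a)
                      := con (+ 5 / 1) :+ ⟨minPoly⟩ a :* (con 2ℚ :* a)) ≈-refl a))
      where
      square : ∀ {x y} → x ≈ y → x ↑ 2 ≈ y ⊠ y
      square {x} {y} e = ≈-trans (^-+2 x 0) (≈-trans (⊠-cong ≈-refl (⊠-cong ≈-refl (^-zero x)))
        (≈-trans (solve 1 (λ x → x :* (x :* con 1ℚ) := x :* x) ≈-refl x) (⊠-cong e e)))

    powerSum-4 : powerSum 4 ≈ ⟦ + 13 / 1 ⟧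
    powerSum-4 = ≈-trans (⊞-cong (⊞-cong (fourth α≈u) (fourth β≈v)) (fourth γ≈-a))
      -- The quotient by `minPoly a`, of degree five, in Horner form; the remainder is 13.
      (≈-mod minPoly-a (⟦ 2ℚ ⟧ ⊠ (⟦ 2ℚ ⟧ ⊞ a ⊠ (⟦ + 6 / 1 ⟧ ⊟ a ⊠ (⟦ 1ℚ ⟧ ⊞ a ⊠ (⟦ 2ℚ ⟧ ⊞ a ⊠ (⟦ 1ℚ ⟧ ⊟ a))))))
        (solve 1 (λ a → ⟨u⟩ a :* ⟨u⟩ a :* (⟨u⟩ a :* ⟨u⟩ a) :+ ⟨v⟩ a :* ⟨v⟩ a :* (⟨v⟩ a :* ⟨v⟩ a) :+ (:- a) :* (:- a) :* ((:- a) :* (:- a))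
          := con (+ 13 / 1) :+ ⟨minPoly⟩ a
             :* (con 2ℚ :* (con 2ℚ :+ a :* (con (+ 6 / 1) :- a :* (con 1ℚ :+ a :* (con 2ℚ :+ a :* (con 1ℚ :- a))))))) ≈-refl a))
      where
      fourth : ∀ {x y} → x ≈ y → x ↑ 4 ≈ y ⊠ y ⊠ (y ⊠ y)
      fourth {x} {y} e = ≈-trans (≈-trans (^-+4 x 0) (⊠-cong ≈-refl (⊠-cong ≈-refl (⊠-cong ≈-refl (⊠-cong ≈-refl (^-zero x))))))
        (≈-trans (solve 1 (λ x → x :* (x :* (x :* (x :* con 1ℚ))) := x :* x :* (x :* x)) ≈-refl x) (⊠-cong (⊠-cong e e) (⊠-cong e e)))

    module _ (A : ℕ → ℚ) (A-0 : A 0 ≡ + 3 / 1) (A-1 : A 1 ≡ + 5 / 1) (A-2 : A 2 ≡ + 13 / 1)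
      (A-recurrence : ∀ n → A (n ℕ.+ 3) ≡ (+ 5 / 1) * A (n ℕ.+ 2) - (+ 6 / 1) * A (n ℕ.+ 1) + A n) where

      private
        Agree : ℕ → Set
        Agree n = ⟦ A n ⟧ ≈ powerSum (2 ℕ.* n)

        shift : ∀ n k → powerSum (2 ℕ.* (n ℕ.+ k)) ≡ powerSum (2 ℕ.* k ℕ.+ 2 ℕ.* n)
        shift n k = cong powerSum (trans (ℕ.*-distribˡ-+ 2 n k) (ℕ.+-comm (2 ℕ.* n) (2 ℕ.* k)))

        step : ∀ n → Agree n → Agree (n ℕ.+ 1) → Agree (n ℕ.+ 2) → Agree (n ℕ.+ 3)
        step n p q r = begin
          ⟦ A (n ℕ.+ 3) ⟧   ≡⟨ cong ⟦_⟧ (A-recurrence n) ⟩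
          ⟦ (+ 5 / 1) * A (n ℕ.+ 2) - (+ 6 / 1) * A (n ℕ.+ 1) + A n ⟧
            ≈⟨ ≈-trans (+-homo _ _) (⊞-cong (≈-trans (+-homo _ _) (⊞-cong (*-homo _ _) (≈-trans (-‿homo _) (⊝-cong (*-homo _ _))))) ≈-refl) ⟩
          ⟦ + 5 / 1 ⟧ ⊠ ⟦ A (n ℕ.+ 2) ⟧ ⊟ ⟦ + 6 / 1 ⟧ ⊠ ⟦ A (n ℕ.+ 1) ⟧ ⊞ ⟦ A n ⟧
            ≈⟨ ⊞-cong (⊞-cong (⊠-cong ≈-refl r) (⊝-cong (⊠-cong ≈-refl q))) p ⟩
          ⟦ + 5 / 1 ⟧ ⊠ powerSum (2 ℕ.* (n ℕ.+ 2)) ⊟ ⟦ + 6 / 1 ⟧ ⊠ powerSum (2 ℕ.* (n ℕ.+ 1)) ⊞ powerSum (2 ℕ.* n)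
            ≡⟨ cong₂ (λ x y → ⟦ + 5 / 1 ⟧ ⊠ x ⊟ ⟦ + 6 / 1 ⟧ ⊠ y ⊞ powerSum (2 ℕ.* n)) (shift n 2) (shift n 1) ⟩
          ⟦ + 5 / 1 ⟧ ⊠ powerSum (4 ℕ.+ 2 ℕ.* n) ⊟ ⟦ + 6 / 1 ⟧ ⊠ powerSum (2 ℕ.+ 2 ℕ.* n) ⊞ powerSum (2 ℕ.* n)
            ≈⟨ powerSum-step (2 ℕ.* n) ⟨
          powerSum (6 ℕ.+ 2 ℕ.* n)     ≡⟨ shift n 3 ⟨
          powerSum (2 ℕ.* (n ℕ.+ 3))   ∎

        -- The recurrence has order three, so the induction carries a window of three consecutive
        -- indices.
        three : ∀ n → Agree n × Agree (n ℕ.+ 1) × Agree (n ℕ.+ 2)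
        three zero    = base A-0 powerSum-0 , base A-1 powerSum-2 , base A-2 powerSum-4
          where
          base : ∀ {q r x} → q ≡ r → x ≈ ⟦ r ⟧ → ⟦ q ⟧ ≈ x
          base refl e = ≈-sym e
        three (suc n) = let p , q , r = three n in
          subst Agree (ℕ.+-comm n 1) q , subst Agree (ℕ.+-suc n 1) r , subst Agree (ℕ.+-suc n 2) (step n p q r)

      A≈powerSum : ∀ n → ⟦ A n ⟧ ≈ powerSum (2 ℕ.* n)
      A≈powerSum n = proj₁ (three n)

    -- Twice the cosines of π / 7, 2π / 7, 3π / 7 are - `γ`, `α`, - `β`, and an even exponent
    -- removes the signs.
    powerSum-cosines : ∀ c₁ c₂ c₃ →
      ⟦ + 2 / 1 ⟧ ⊠ c₁ ≈ D (+ 2 / 7) → ⟦ + 2 / 1 ⟧ ⊠ c₂ ≈ D (+ 4 / 7) → ⟦ + 2 / 1 ⟧ ⊠ c₃ ≈ D (+ 6 / 7) → ∀ n →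
      powerSum (2 ℕ.* n) ≈ ⟦ + 2 / 1 ⟧ ↑ (2 ℕ.* n) ⊠ (c₁ ↑ (2 ℕ.* n) ⊞ c₂ ↑ (2 ℕ.* n) ⊞ c₃ ↑ (2 ℕ.* n))
    powerSum-cosines c₁ c₂ c₃ e₁ e₂ e₃ n = begin
      α ↑ m ⊞ β ↑ m ⊞ γ ↑ m
        ≈⟨ ⊞-cong (⊞-cong
             (≈-trans (^-cong m (≈-trans α≈ (≈-sym e₂))) (^-distrib-* two c₂ m))
             (≈-trans (^-cong m β≈v) (≈-trans (≈-sym (^-neg-even v n))
               (≈-trans (^-cong m (≈-sym (≈-trans e₃ D[6/7]))) (^-distrib-* two c₃ m)))))
             (≈-trans (^-cong m γ≈-a) (≈-trans (^-neg-even a n)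
               (≈-trans (^-cong m (≈-sym e₁)) (^-distrib-* two c₁ m)))) ⟩
      s ⊠ c₂ ↑ m ⊞ s ⊠ c₃ ↑ m ⊞ s ⊠ c₁ ↑ m
        ≈⟨ solve 4 (λ s x y z → s :* y :+ s :* z :+ s :* x := s :* (x :+ y :+ z)) ≈-refl s (c₁ ↑ m) (c₂ ↑ m) (c₃ ↑ m) ⟩
      s ⊠ (c₁ ↑ m ⊞ c₂ ↑ m ⊞ c₃ ↑ m) ∎
      where
      m : ℕ
      m = 2 ℕ.* n
      two s : X
      two = ⟦ + 2 / 1 ⟧
      s = two ↑ m

-- Closed walks on P₆

-- Counting with Boolean tests: the `does` part of a composite decision computes to a conjunction,
-- which can be split vertex by vertex.
count : {X : Set} → (X → Bool) → List X → ℕ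
count p []       = 0
count p (x ∷ xs) = (if p x then 1 else 0) ℕ.+ count p xs

length-filter≡count : {X : Set} {P : Pred X 0ℓ} (P? : Decidable P) → ∀ xs →
                      length (filter P? xs) ≡ count (does ∘ P?) xs
length-filter≡count P? []       = refl
length-filter≡count P? (x ∷ xs) with does (P? x)
... | false = length-filter≡count P? xs
... | true  = cong suc (length-filter≡count P? xs)

count-cong : {X : Set} {p q : X → Bool} → (∀ x → p x ≡ q x) → ∀ xs → count p xs ≡ count q xs
count-cong p≗q []       = refl
count-cong p≗q (x ∷ xs) = cong₂ (λ b n → (if b then 1 else 0) ℕ.+ n) (p≗q x) (count-cong p≗q xs)

count-∧ : {X : Set} (b : Bool) (p : X → Bool) → ∀ xs →
          count (λ x → b ∧ p x) xs ≡ (if b then count p xs else 0)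
count-∧ true  p xs       = refl
count-∧ false p []       = refl
count-∧ false p (x ∷ xs) = count-∧ false p xs

count-map : {X Y : Set} (p : Y → Bool) (f : X → Y) → ∀ xs → count p (List.map f xs) ≡ count (p ∘ f) xs
count-map p f []       = refl
count-map p f (x ∷ xs) = cong ((if p (f x) then 1 else 0) ℕ.+_) (count-map p f xs)

count-++ : {X : Set} (p : X → Bool) → ∀ xs ys → count p (xs List.++ ys) ≡ count p xs ℕ.+ count p ys
count-++ p []       ys = refl
count-++ p (x ∷ xs) ys = trans (cong ((if p x then 1 else 0) ℕ.+_) (count-++ p xs ys))
  (sym (ℕ.+-assoc (if p x then 1 else 0) (count p xs) (count p ys)))

count-cartesianProductWith : {X Y Z : Set} (p : Z → Bool) (f : X → Y → Z) → ∀ xs ys →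
  count p (cartesianProductWith f xs ys) ≡ sum (List.map (λ x → count (p ∘ f x) ys) xs)
count-cartesianProductWith p f []       ys = refl
count-cartesianProductWith p f (x ∷ xs) ys =
  trans (count-++ p (List.map (f x) ys) (cartesianProductWith f xs ys))
    (cong₂ ℕ._+_ (count-map p (f x) ys) (count-cartesianProductWith p f xs ys))

module _ {m : ℕ} where

  -- The start `i` is kept outside the vector, so vectors of length `l` list the walks with `l`
  -- steps. For `j` = `i` this computes to the test of `isClosedWalk?` on `i Vec.∷ v`.
  isWalk : ∀ {l} → Fin m → Fin m → Vec (Fin m) l → Bool
  isWalk i j v = does (linked? adjacent? (i Vec.∷ v)) ∧ does (j Fin.≟ Vec.last (i Vec.∷ v))

  walks : ℕ → Fin m → Fin m → ℕ
  walks l i j = count (isWalk i j) (allVecs m l)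

  -- Decomposition by the first step, the entrywise form of J^(l+1) = J · J^l. Linkedness and last
  -- vertex both compute on `i ∷ k ∷ v`, which leaves a reassociation of `∧`.
  walks-suc : ∀ l i j → walks (suc l) i j ≡
    sum (List.map (λ k → if does (adjacent? i k) then walks l k j else 0) (allFin m))
  walks-suc l i j = trans (count-cartesianProductWith (isWalk i j) Vec._∷_ (allFin m) (allVecs m l))
    (cong sum (List.map-cong (λ k → trans
        (count-cong (λ v → ∧-assoc (does (adjacent? i k)) (does (linked? adjacent? (k Vec.∷ v))) (does (j Fin.≟ Vec.last (k Vec.∷ v)))) (allVecs m l))
        (count-∧ (does (adjacent? i k)) (isWalk k j) (allVecs m l)))
      (allFin m)))

w≡trace : ∀ m l → w m l ≡ sum (List.map (λ i → walks l i i) (allFin m))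
w≡trace m l = trans (length-filter≡count isClosedWalk? (allVecs m (suc l)))
  (count-cartesianProductWith (does ∘ isClosedWalk?) Vec._∷_ (allFin m) (allVecs m l))

-- The adjacency operator of P₆, over any additive structure so that it also
-- acts on the expressions of the ring solver.
module _ {X : Set} (_⊕_ : X → X → X) where

  J : (Fin 6 → X) → Fin 6 → X
  J f 0F = f 1F
  J f 1F = f 0F ⊕ f 2F
  J f 2F = f 1F ⊕ f 3F
  J f 3F = f 2F ⊕ f 4F
  J f 4F = f 3F ⊕ f 5F
  J f 5F = f 4F

  J^ : ℕ → (Fin 6 → X) → Fin 6 → X
  J^ zero    f = f
  J^ (suc n) f = J (J^ n f)

J-cong : ∀ {f g : Fin 6 → ℕ} → (∀ i → f i ≡ g i) → ∀ i → J ℕ._+_ f i ≡ J ℕ._+_ g i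
J-cong e 0F = e 1F
J-cong e 1F = cong₂ ℕ._+_ (e 0F) (e 2F)
J-cong e 2F = cong₂ ℕ._+_ (e 1F) (e 3F)
J-cong e 3F = cong₂ ℕ._+_ (e 2F) (e 4F)
J-cong e 4F = cong₂ ℕ._+_ (e 3F) (e 5F)
J-cong e 5F = e 4F

walks₆-suc : ∀ l i j → walks (suc l) i j ≡ J ℕ._+_ (λ k → walks l k j) i
walks₆-suc l i j = trans (walks-suc l i j) (row i)
  where
  f : Fin 6 → ℕ
  f k = walks l k j
  row : ∀ i → sum (List.map (λ k → if does (adjacent? i k) then f k else 0) (allFin 6)) ≡ J ℕ._+_ f i
  -- For a concrete vertex all six adjacency tests evaluate, and the sum reduces to its neighbours
  -- and a trailing zero.
  row 0F = ℕ.+-identityʳ (f 1F)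
  row 1F = cong (f 0F ℕ.+_) (ℕ.+-identityʳ (f 2F))
  row 2F = cong (f 1F ℕ.+_) (ℕ.+-identityʳ (f 3F))
  row 3F = cong (f 2F ℕ.+_) (ℕ.+-identityʳ (f 4F))
  row 4F = cong (f 3F ℕ.+_) (ℕ.+-identityʳ (f 5F))
  row 5F = ℕ.+-identityʳ (f 4F)

-- Cayley–Hamilton: the characteristic polynomial of J is x⁶ - 5x⁴ + 6x² - 1.
cayley-hamilton : ∀ (f : Fin 6 → ℕ) i →
  J^ ℕ._+_ 6 f i ℕ.+ 6 ℕ.* J^ ℕ._+_ 2 f i ≡ 5 ℕ.* J^ ℕ._+_ 4 f i ℕ.+ f i
cayley-hamilton f = λ
  { 0F → at 0F refl ; 1F → at 1F refl ; 2F → at 2F refl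
  ; 3F → at 3F refl ; 4F → at 4F refl ; 5F → at 5F refl }
  where
  open ℕSolver using (Polynomial; ⟦_⟧; ⟦_⟧↓; prove; var) renaming (con to c; _:+_ to _⊕_; _:*_ to _⊗_)
  ρ : Vec ℕ 6
  ρ = Vec.tabulate f
  lhs rhs : Fin 6 → Polynomial 6
  lhs i = J^ _⊕_ 6 var i ⊕ c 6 ⊗ J^ _⊕_ 2 var i
  rhs i = c 5 ⊗ J^ _⊕_ 4 var i ⊕ var i
  at : ∀ i → ⟦ lhs i ⟧↓ ρ ≡ ⟦ rhs i ⟧↓ ρ → ⟦ lhs i ⟧ ρ ≡ ⟦ rhs i ⟧ ρ
  at i = prove ρ (lhs i) (rhs i)

module _ (N : ℕ → Fin 6 → Fin 6 → ℕ) (N-suc : ∀ l i j → N (suc l) i j ≡ J ℕ._+_ (λ k → N l k j) i) where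

  open ℕSolver using (solve; con; _:+_; _:*_; _:=_)

  trace : ℕ → List (Fin 6) → ℕ
  trace l is = sum (List.map (λ i → N l i i) is)

  power-+ : ∀ k l i j → N (k ℕ.+ l) i j ≡ J^ ℕ._+_ k (λ k → N l k j) i
  power-+ zero    l i j = refl
  power-+ (suc k) l i j = trans (N-suc (k ℕ.+ l) i j) (J-cong (λ i → power-+ k l i j) i)

  power-recurrence : ∀ l i j → N (6 ℕ.+ l) i j ℕ.+ 6 ℕ.* N (2 ℕ.+ l) i j ≡ 5 ℕ.* N (4 ℕ.+ l) i j ℕ.+ N l i j
  power-recurrence l i j = trans (cong₂ (λ x y → x ℕ.+ 6 ℕ.* y) (power-+ 6 l i j) (power-+ 2 l i j))
    (trans (cayley-hamilton (λ k → N l k j) i) (cong (λ x → 5 ℕ.* x ℕ.+ N l i j) (sym (power-+ 4 l i j))))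

  -- The entrywise recurrence is linear, so it may be summed over any list of diagonal positions;
  -- the list is general to allow induction.
  trace-recurrence : ∀ l is → trace (6 ℕ.+ l) is ℕ.+ 6 ℕ.* trace (2 ℕ.+ l) is ≡ 5 ℕ.* trace (4 ℕ.+ l) is ℕ.+ trace l is
  trace-recurrence l []       = refl
  trace-recurrence l (i ∷ is) = trans
    (solve 4 (λ a b c d → (a :+ b) :+ con 6 :* (c :+ d)
                       := (a :+ con 6 :* c) :+ (b :+ con 6 :* d)) refl
      (N (6 ℕ.+ l) i i) (trace (6 ℕ.+ l) is) (N (2 ℕ.+ l) i i) (trace (2 ℕ.+ l) is))
    (trans (cong₂ ℕ._+_ (power-recurrence l i i) (trace-recurrence l is))
      (solve 4 (λ a b c d → (con 5 :* a :+ b) :+ (con 5 :* c :+ d)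
                         := con 5 :* (a :+ c) :+ (b :+ d)) refl
        (N (4 ℕ.+ l) i i) (N l i i) (trace (4 ℕ.+ l) is) (trace l is)))

w₆-recurrence : ∀ l → w 6 (6 ℕ.+ l) ℕ.+ 6 ℕ.* w 6 (2 ℕ.+ l) ≡ 5 ℕ.* w 6 (4 ℕ.+ l) ℕ.+ w 6 l
w₆-recurrence l = trans (cong₂ (λ x y → x ℕ.+ 6 ℕ.* y) (w≡trace 6 (6 ℕ.+ l)) (w≡trace 6 (2 ℕ.+ l)))
  (trans (trace-recurrence walks walks₆-suc l (allFin 6))
    (sym (cong₂ (λ x y → 5 ℕ.* x ℕ.+ y) (w≡trace 6 (4 ℕ.+ l)) (w≡trace 6 l))))

-- The recurrence of `A` over the rationals

open +-*-Solver using (solve; con; _:+_; _:*_; :-_; _:-_; _:=_)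

ι-+ : ∀ m n → ι (m ℕ.+ n) ≡ ι m + ι n
ι-+ zero    n = sym (+-identityˡ (ι n))
ι-+ (suc m) n = trans (ι-suc (m ℕ.+ n)) (trans (cong (λ z → 1ℚ + z) (ι-+ m n))
  (trans (sym (+-assoc 1ℚ (ι m) (ι n))) (cong (_+ ι n) (sym (ι-suc m)))))

ι-* : ∀ m n → ι (m ℕ.* n) ≡ ι m * ι n
ι-* zero    n = sym (*-zeroˡ (ι n))
ι-* (suc m) n = trans (ι-+ n (m ℕ.* n)) (trans (cong (λ z → ι n + z) (ι-* m n))
  (trans (solve 2 (λ m n → n :+ m :* n := (con 1ℚ :+ m) :* n) refl (ι m) (ι n)) (cong (_* ι n) (sym (ι-suc m)))))

/2≡ι*½ : ∀ n → + n / 2 ≡ ι n * ½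
/2≡ι*½ n = toℚᵘ-injective (ℚᵘ.≃-trans (toℚᵘ-fromℚᵘ (ℚᵘ.mkℚᵘ (+ n) 1))
  (ℚᵘ.≃-sym (ℚᵘ.≃-trans (toℚᵘ-homo-* (ι n) ½)
    (ℚᵘ.≃-trans (ℚᵘ.*-congʳ {toℚᵘ ½} (toℚᵘ-fromℚᵘ (ℚᵘ.mkℚᵘ (+ n) 0)))
      (ℚᵘ.*≡* (cong (ℤ._* + 2) (ℤ.*-identityʳ (+ n))))))))

-- Half of `w₆-recurrence` at even lengths. Over ℕ the term with 6 stands on the left; here it
-- becomes a genuine subtraction.
A-recurrence : ∀ n → A (n ℕ.+ 3) ≡ (+ 5 / 1) * A (n ℕ.+ 2) - (+ 6 / 1) * A (n ℕ.+ 1) + A n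
A-recurrence n = begin
  A (n ℕ.+ 3)                                             ≡⟨ A≡ 3 ⟩
  a₆ * ½                                                  ≡⟨ solve 2 (λ x y → x :* con ½ := (x :+ con 6ℚ :* y) :* con ½ :- con 6ℚ :* (y :* con ½)) refl a₆ a₂ ⟩
  (a₆ + 6ℚ * a₂) * ½ - 6ℚ * (a₂ * ½)                      ≡⟨ cong (λ z → z * ½ - 6ℚ * (a₂ * ½)) key ⟩
  (5ℚ * a₄ + a₀) * ½ - 6ℚ * (a₂ * ½)                      ≡⟨ solve 3 (λ x y z → (con 5ℚ :* x :+ z) :* con ½ :- con 6ℚ :* (y :* con ½) :=
                                                               con 5ℚ :* (x :* con ½) :- con 6ℚ :* (y :* con ½) :+ z :* con ½) refl a₄ a₂ a₀ ⟩
  5ℚ * (a₄ * ½) - 6ℚ * (a₂ * ½) + a₀ * ½                  ≡⟨ cong₂ _+_ (cong₂ (λ x y → 5ℚ * x - 6ℚ * y) (A≡ 2) (A≡ 1)) (/2≡ι*½ (w 6 (2 ℕ.* n))) ⟨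
  5ℚ * A (n ℕ.+ 2) - 6ℚ * A (n ℕ.+ 1) + A n               ∎
  where
  open ≡-Reasoning
  5ℚ 6ℚ a₀ a₂ a₄ a₆ : ℚ
  5ℚ = + 5 / 1
  6ℚ = + 6 / 1
  l : ℕ
  l = 2 ℕ.* n
  a₀ = ι (w 6 l)
  a₂ = ι (w 6 (2 ℕ.+ l))
  a₄ = ι (w 6 (4 ℕ.+ l))
  a₆ = ι (w 6 (6 ℕ.+ l))
  A≡ : ∀ k → A (n ℕ.+ k) ≡ ι (w 6 (2 ℕ.* k ℕ.+ l)) * ½
  A≡ k = trans (/2≡ι*½ (w 6 (2 ℕ.* (n ℕ.+ k))))
    (cong (λ z → ι (w 6 z) * ½) (trans (ℕ.*-distribˡ-+ 2 n k) (ℕ.+-comm (2 ℕ.* n) (2 ℕ.* k))))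
  key : a₆ + 6ℚ * a₂ ≡ 5ℚ * a₄ + a₀
  key = trans (sym (trans (ι-+ (w 6 (6 ℕ.+ l)) (6 ℕ.* w 6 (2 ℕ.+ l))) (cong (λ z → a₆ + z) (ι-* 6 (w 6 (2 ℕ.+ l))))))
    (trans (cong ι (w₆-recurrence l)) (trans (ι-+ (5 ℕ.* w 6 (4 ℕ.+ l)) (w 6 l)) (cong (_+ a₀) (ι-* 5 (w 6 (4 ℕ.+ l))))))

-- The addition theorem for the cosine

Stream : Set
Stream = ℕ → ℚ

-- conv f g n = Σ_{i+j=n} f i * g j.
conv : Stream → Stream → Stream
conv f g zero    = f 0 * g 0
conv f g (suc n) = f 0 * g (suc n) + conv (f ∘ suc) g n

conv-cong : ∀ {f f′ g g′ : Stream} → (∀ i → f i ≡ f′ i) → (∀ j → g j ≡ g′ j) → ∀ n → conv f g n ≡ conv f′ g′ n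
conv-cong p q zero    = cong₂ _*_ (p 0) (q 0)
conv-cong p q (suc n) = cong₂ _+_ (cong₂ _*_ (p 0) (q (suc n))) (conv-cong (p ∘ suc) q n)

conv-+ˡ : ∀ f f′ g n → conv (λ i → f i + f′ i) g n ≡ conv f g n + conv f′ g n
conv-+ˡ f f′ g zero    = *-distribʳ-+ (g 0) (f 0) (f′ 0)
conv-+ˡ f f′ g (suc n) = trans (cong (λ z → (f 0 + f′ 0) * g (suc n) + z) (conv-+ˡ (f ∘ suc) (f′ ∘ suc) g n))
  (solve 5 (λ a b c x y → (a :+ b) :* c :+ (x :+ y) := (a :* c :+ x) :+ (b :* c :+ y)) refl
    (f 0) (f′ 0) (g (suc n)) (conv (f ∘ suc) g n) (conv (f′ ∘ suc) g n))

conv-+ʳ : ∀ f g g′ n → conv f (λ j → g j + g′ j) n ≡ conv f g n + conv f g′ n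
conv-+ʳ f g g′ zero    = *-distribˡ-+ (f 0) (g 0) (g′ 0)
conv-+ʳ f g g′ (suc n) = trans (cong (λ z → f 0 * (g (suc n) + g′ (suc n)) + z) (conv-+ʳ (f ∘ suc) g g′ n))
  (solve 5 (λ a b c x y → c :* (a :+ b) :+ (x :+ y) := (c :* a :+ x) :+ (c :* b :+ y)) refl
    (g (suc n)) (g′ (suc n)) (f 0) (conv (f ∘ suc) g n) (conv (f ∘ suc) g′ n))

conv-*ˡ : ∀ c f g n → conv (λ i → c * f i) g n ≡ c * conv f g n
conv-*ˡ c f g zero    = *-assoc c (f 0) (g 0)
conv-*ˡ c f g (suc n) = trans (cong (λ z → c * f 0 * g (suc n) + z) (conv-*ˡ c (f ∘ suc) g n))
  (solve 4 (λ c a b x → c :* a :* b :+ c :* x := c :* (a :* b :+ x)) refl c (f 0) (g (suc n)) (conv (f ∘ suc) g n))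

conv-*ʳ : ∀ c f g n → conv f (λ j → c * g j) n ≡ c * conv f g n
conv-*ʳ c f g zero    = solve 3 (λ c a b → a :* (c :* b) := c :* (a :* b)) refl c (f 0) (g 0)
conv-*ʳ c f g (suc n) = trans (cong (λ z → f 0 * (c * g (suc n)) + z) (conv-*ʳ c (f ∘ suc) g n))
  (solve 4 (λ c a b x → a :* (c :* b) :+ c :* x := c :* (a :* b :+ x)) refl c (f 0) (g (suc n)) (conv (f ∘ suc) g n))

-- Since s^i · s^j = s^(i+j); with s = -1 this extracts the alternating signs of the cosine series.
conv-twist : ∀ s f g n → conv (λ i → s ^ i * f i) (λ j → s ^ j * g j) n ≡ s ^ n * conv f g n
conv-twist s f g zero    = solve 2 (λ a b → con 1ℚ :* a :* (con 1ℚ :* b) := con 1ℚ :* (a :* b)) refl (f 0) (g 0)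
conv-twist s f g (suc n) = begin
  1ℚ * f 0 * (s * s ^ n * g (suc n)) + conv (λ i → s * s ^ i * f (suc i)) g′ n
    ≡⟨ cong (λ z → 1ℚ * f 0 * (s * s ^ n * g (suc n)) + z)
         (trans (conv-cong (λ i → *-assoc s (s ^ i) (f (suc i))) (λ _ → refl) n)
           (trans (conv-*ˡ s (λ i → s ^ i * f (suc i)) g′ n) (cong (s *_) (conv-twist s (f ∘ suc) g n)))) ⟩
  1ℚ * f 0 * (s * s ^ n * g (suc n)) + s * (s ^ n * conv (f ∘ suc) g n)
    ≡⟨ solve 5 (λ s p a b x → con 1ℚ :* a :* (s :* p :* b) :+ s :* (p :* x) := s :* p :* (a :* b :+ x)) refl
         s (s ^ n) (f 0) (g (suc n)) (conv (f ∘ suc) g n) ⟩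
  s * s ^ n * (f 0 * g (suc n) + conv (f ∘ suc) g n) ∎
  where
  open ≡-Reasoning
  g′ : Stream
  g′ j = s ^ j * g j

-- The formal derivative of the power series with coefficients `f`; `conv` is the product of such
-- series.
deriv : Stream → Stream
deriv f n = ι (suc n) * f (suc n)

-- With f = f(0) + x h and h the shifted series, this is f′ = h + x h′.
deriv-∘suc : ∀ f n → deriv f (suc n) ≡ f (suc (suc n)) + deriv (f ∘ suc) n
deriv-∘suc f n = trans (cong (_* f (suc (suc n))) (ι-suc (suc n)))
  (solve 2 (λ i x → (con 1ℚ :+ i) :* x := x :+ i :* x) refl (ι (suc n)) (f (suc (suc n))))

leibniz : ∀ f g n → deriv (conv f g) n ≡ conv (deriv f) g n + conv f (deriv g) n
leibniz f g zero    = solve 4 (λ a b c d → con (ι 1) :* (a :* d :+ b :* c) := con (ι 1) :* b :* c :+ a :* (con (ι 1) :* d)) refl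
  (f 0) (f 1) (g 0) (g 1)
leibniz f g (suc n) = begin
  ι (2 ℕ.+ n) * (a * b + c)                              ≡⟨ *-distribˡ-+ (ι (2 ℕ.+ n)) (a * b) c ⟩
  ι (2 ℕ.+ n) * (a * b) + ι (2 ℕ.+ n) * c                ≡⟨ cong (λ z → ι (2 ℕ.+ n) * (a * b) + z * c) (ι-suc (suc n)) ⟩
  ι (2 ℕ.+ n) * (a * b) + (1ℚ + ι (suc n)) * c           ≡⟨ solve 5 (λ i j a b c → i :* (a :* b) :+ (con 1ℚ :+ j) :* c := a :* (i :* b) :+ (c :+ j :* c)) refl
                                                              (ι (2 ℕ.+ n)) (ι (suc n)) a b c ⟩
  a * deriv g (suc n) + (c + deriv (conv (f ∘ suc) g) n) ≡⟨ cong (λ z → a * deriv g (suc n) + (c + z)) (leibniz (f ∘ suc) g n) ⟩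
  a * deriv g (suc n) + (f 1 * g (suc n) + x + (y + z))  ≡⟨ solve 5 (λ t u x y z → t :+ (u :+ x :+ (y :+ z)) := (u :+ (x :+ y)) :+ (t :+ z)) refl
                                                              (a * deriv g (suc n)) (f 1 * g (suc n)) x y z ⟩
  (f 1 * g (suc n) + (x + y)) + (a * deriv g (suc n) + z) ≡⟨ cong (_+ (a * deriv g (suc n) + z)) (cong₂ _+_
                                                              (cong (_* g (suc n)) (sym (*-identityˡ (f 1))))
                                                              (sym (trans (conv-cong (deriv-∘suc f) (λ _ → refl) n)
                                                                (conv-+ˡ (f ∘ suc ∘ suc) (deriv (f ∘ suc)) g n)))) ⟩
  conv (deriv f) g (suc n) + conv f (deriv g) (suc n)    ∎
  where
  open ≡-Reasoning
  a = f 0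
  b = g (2 ℕ.+ n)
  c = conv (f ∘ suc) g (suc n)
  x = conv (f ∘ suc ∘ suc) g n
  y = conv (deriv (f ∘ suc)) g n
  z = conv (f ∘ suc) (deriv g) n

inv! : ℕ → ℚ
inv! n = inv (n !) {{n ℕ.!≢0}}

-- The coefficients of exp (p x) as a power series in x.
expTerm : ℚ → Stream
expTerm p n = p ^ n * inv! n

ι*inv!-suc : ∀ n → ι (suc n) * inv! (suc n) ≡ inv! n
ι*inv!-suc n = trans
  (cong (ι (suc n) *_) (inv-* (suc n) (n !) {{_}} {{n ℕ.!≢0}} {{suc n ℕ.!≢0}}))
  (trans (sym (*-assoc (ι (suc n)) (inv (suc n)) (inv! n)))
    (trans (cong (_* inv! n) (ι*inv (suc n))) (*-identityˡ (inv! n))))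

deriv-expTerm : ∀ p n → deriv (expTerm p) n ≡ p * expTerm p n
deriv-expTerm p n = trans
  (solve 4 (λ i p x y → i :* (p :* x :* y) := p :* (x :* (i :* y))) refl (ι (suc n)) p (p ^ n) (inv! (suc n)))
  (cong (λ z → p * (p ^ n * z)) (ι*inv!-suc n))

ι-cancelˡ : ∀ n {x y} → ι (suc n) * x ≡ ι (suc n) * y → x ≡ y
ι-cancelˡ n {x} {y} e = trans (sym (undo x)) (trans (cong (inv (suc n) *_) e) (undo y))
  where
  undo : ∀ z → inv (suc n) * (ι (suc n) * z) ≡ z
  undo z = trans (solve 3 (λ i j z → i :* (j :* z) := j :* i :* z) refl (inv (suc n)) (ι (suc n)) z)
    (trans (cong (_* z) (ι*inv (suc n))) (*-identityˡ z))

-- Both sides have the same value at 0 and satisfy h′ = (p + q) h.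
conv-expTerm : ∀ p q n → conv (expTerm p) (expTerm q) n ≡ expTerm (p + q) n
conv-expTerm p q zero    = refl
conv-expTerm p q (suc n) = ι-cancelˡ n (begin
  deriv (conv (expTerm p) (expTerm q)) n                           ≡⟨ leibniz (expTerm p) (expTerm q) n ⟩
  conv (deriv (expTerm p)) (expTerm q) n + conv (expTerm p) (deriv (expTerm q)) n
    ≡⟨ cong₂ _+_
         (trans (conv-cong (deriv-expTerm p) (λ _ → refl) n) (conv-*ˡ p (expTerm p) (expTerm q) n))
         (trans (conv-cong {expTerm p} (λ _ → refl) (deriv-expTerm q) n) (conv-*ʳ q (expTerm p) (expTerm q) n)) ⟩
  p * conv (expTerm p) (expTerm q) n + q * conv (expTerm p) (expTerm q) n  ≡⟨ *-distribʳ-+ (conv (expTerm p) (expTerm q) n) p q ⟨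
  (p + q) * conv (expTerm p) (expTerm q) n                         ≡⟨ cong ((p + q) *_) (conv-expTerm p q n) ⟩
  (p + q) * expTerm (p + q) n                                      ≡⟨ deriv-expTerm (p + q) n ⟨
  deriv (expTerm (p + q)) n                                        ∎)
  where open ≡-Reasoning

-- When i + j and j are even, so is i: evenness of one factor suffices to discard all odd terms of
-- the other.
conv-even : ∀ f g → (∀ k → g (suc (2 ℕ.* k)) ≡ 0ℚ) → ∀ n → conv f g (2 ℕ.* n) ≡ conv (f ∘ (2 ℕ.*_)) (g ∘ (2 ℕ.*_)) n
conv-even f g g-odd zero    = refl
conv-even f g g-odd (suc n) = begin
  conv f g (2 ℕ.* suc n)                                                  ≡⟨ cong (conv f g) (ℕ.*-suc 2 n) ⟩
  f 0 * g (2 ℕ.+ 2 ℕ.* n) + (f 1 * g (suc (2 ℕ.* n)) + conv (f ∘ suc ∘ suc) g (2 ℕ.* n))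
    ≡⟨ cong₂ (λ u v → f 0 * g u + (f 1 * v + conv (f ∘ suc ∘ suc) g (2 ℕ.* n))) (sym (ℕ.*-suc 2 n)) (g-odd n) ⟩
  f 0 * g (2 ℕ.* suc n) + (f 1 * 0ℚ + conv (f ∘ suc ∘ suc) g (2 ℕ.* n))
    ≡⟨ cong (λ z → f 0 * g (2 ℕ.* suc n) + z)
         (trans (solve 2 (λ a x → a :* con 0ℚ :+ x := x) refl (f 1) (conv (f ∘ suc ∘ suc) g (2 ℕ.* n)))
           (trans (conv-even (f ∘ suc ∘ suc) g g-odd n)
             (conv-cong (λ i → cong f (sym (ℕ.*-suc 2 i))) (λ _ → refl) n))) ⟩
  conv (f ∘ (2 ℕ.*_)) (g ∘ (2 ℕ.*_)) (suc n)                              ∎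
  where open ≡-Reasoning

neg-^-even : ∀ q k → (- q) ^ (2 ℕ.* k) ≡ q ^ (2 ℕ.* k)
neg-^-even q k = trans (^-double (- q) k)
  (trans (cong (_^ k) (solve 1 (λ q → (:- q) :* (:- q) := q :* q) refl q)) (sym (^-double q k)))

-- Up to the sign (-1)^n these are the even coefficients of exp p · (exp q + exp (-q)) = exp (p + q)
-- + exp (p - q). The bracket is an even series, so `conv-even` reduces the left side to the even
-- part of exp p.
conv-cosTerm : ∀ p q n → 2ℚ * conv (cosTerm p) (cosTerm q) n ≡ cosTerm (p + q) n + cosTerm (p - q) n
conv-cosTerm p q n = begin
  2ℚ * conv (cosTerm p) (cosTerm q) n
    ≡⟨ cong (2ℚ *_) (trans (conv-cong (cosTerm≡ p) (cosTerm≡ q) n) (conv-twist s (even p) (even q) n)) ⟩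
  2ℚ * (s ^ n * conv (even p) (even q) n)
    ≡⟨ solve 2 (λ x y → con 2ℚ :* (x :* y) := x :* (con 2ℚ :* y)) refl (s ^ n) (conv (even p) (even q) n) ⟩
  s ^ n * (2ℚ * conv (even p) (even q) n)
    ≡⟨ cong (s ^ n *_) (begin
         2ℚ * conv (even p) (even q) n          ≡⟨ conv-*ʳ 2ℚ (even p) (even q) n ⟨
         conv (even p) (λ j → 2ℚ * even q j) n  ≡⟨ conv-cong {even p} (λ _ → refl) even-even n ⟨
         conv (even p) (g ∘ (2 ℕ.*_)) n         ≡⟨ conv-even (expTerm p) g odd-zero n ⟨
         conv (expTerm p) g (2 ℕ.* n)           ≡⟨ conv-+ʳ (expTerm p) (expTerm q) (expTerm (- q)) (2 ℕ.* n) ⟩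
         conv (expTerm p) (expTerm q) (2 ℕ.* n) + conv (expTerm p) (expTerm (- q)) (2 ℕ.* n)
           ≡⟨ cong₂ _+_ (conv-expTerm p q (2 ℕ.* n)) (conv-expTerm p (- q) (2 ℕ.* n)) ⟩
         even (p + q) n + even (p - q) n        ∎) ⟩
  s ^ n * (even (p + q) n + even (p - q) n)
    ≡⟨ *-distribˡ-+ (s ^ n) (even (p + q) n) (even (p - q) n) ⟩
  s ^ n * even (p + q) n + s ^ n * even (p - q) n
    ≡⟨ cong₂ _+_ (cosTerm≡ (p + q) n) (cosTerm≡ (p - q) n) ⟨
  cosTerm (p + q) n + cosTerm (p - q) n ∎
  where
  open ≡-Reasoning
  s : ℚ
  s = - 1ℚ
  even : ℚ → Stream
  even p i = expTerm p (2 ℕ.* i)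
  g : Stream
  g j = expTerm q j + expTerm (- q) j
  cosTerm≡ : ∀ p i → cosTerm p i ≡ s ^ i * even p i
  cosTerm≡ p i = *-assoc (s ^ i) (p ^ (2 ℕ.* i)) (invFact i)
  even-even : ∀ j → g (2 ℕ.* j) ≡ 2ℚ * even q j
  even-even j = trans (cong (λ z → even q j + z * inv! (2 ℕ.* j)) (neg-^-even q j))
    (solve 1 (λ x → x :+ x := con 2ℚ :* x) refl (even q j))
  odd-zero : ∀ j → g (suc (2 ℕ.* j)) ≡ 0ℚ
  odd-zero j = trans (cong (λ z → expTerm q (suc (2 ℕ.* j)) + (- q) * z * inv! (suc (2 ℕ.* j))) (neg-^-even q j))
    (solve 3 (λ q x y → q :* x :* y :+ (:- q) :* x :* y := con 0ℚ) refl q (q ^ (2 ℕ.* j)) (inv! (suc (2 ℕ.* j))))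

-- Partial sums and the error of the truncated Cauchy product

Σ<-suc : ∀ n f → Σ< (suc n) f ≡ f 0 + Σ< n (f ∘ suc)
Σ<-suc zero    f = +-comm 0ℚ (f 0)
Σ<-suc (suc n) f = trans (cong (_+ f (suc n)) (Σ<-suc n f)) (+-assoc (f 0) (Σ< n (f ∘ suc)) (f (suc n)))

Σ<-+ : ∀ n f g → Σ< n (λ k → f k + g k) ≡ Σ< n f + Σ< n g
Σ<-+ zero    f g = refl
Σ<-+ (suc n) f g = trans (cong (_+ (f n + g n)) (Σ<-+ n f g))
  (solve 4 (λ a b c d → (a :+ b) :+ (c :+ d) := (a :+ c) :+ (b :+ d)) refl (Σ< n f) (Σ< n g) (f n) (g n))

Σ<-* : ∀ n c f → Σ< n (λ k → c * f k) ≡ c * Σ< n f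
Σ<-* zero    c f = sym (*-zeroʳ c)
Σ<-* (suc n) c f = trans (cong (_+ c * f n) (Σ<-* n c f)) (sym (*-distribˡ-+ c (Σ< n f) (f n)))

Σ<-cong : ∀ n {f g} → (∀ k → f k ≡ g k) → Σ< n f ≡ Σ< n g
Σ<-cong zero    e = refl
Σ<-cong (suc n) e = cong₂ _+_ (Σ<-cong n e) (e n)

-- Summation by rows of the triangle: the row of `f 0` is split off, and the rows of the shifted `f`
-- form a triangle one smaller.
Σ<-conv : ∀ n f g → Σ< (suc n) (conv f g) ≡ f 0 * Σ< (suc n) g + Σ< n (conv (f ∘ suc) g)
Σ<-conv n f g = begin
  Σ< (suc n) (conv f g)                                                    ≡⟨ Σ<-suc n (conv f g) ⟩
  f 0 * g 0 + Σ< n (λ k → f 0 * g (suc k) + conv (f ∘ suc) g k)            ≡⟨ cong (λ z → f 0 * g 0 + z) (trans (Σ<-+ n (λ k → f 0 * g (suc k)) (conv (f ∘ suc) g))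
                                                                                (cong (_+ Σ< n (conv (f ∘ suc) g)) (Σ<-* n (f 0) (g ∘ suc)))) ⟩
  f 0 * g 0 + (f 0 * Σ< n (g ∘ suc) + Σ< n (conv (f ∘ suc) g))             ≡⟨ solve 4 (λ a b c d → a :* b :+ (a :* c :+ d) := a :* (b :+ c) :+ d) refl
                                                                                (f 0) (g 0) (Σ< n (g ∘ suc)) (Σ< n (conv (f ∘ suc) g)) ⟩
  f 0 * (g 0 + Σ< n (g ∘ suc)) + Σ< n (conv (f ∘ suc) g)                   ≡⟨ cong (λ z → f 0 * z + Σ< n (conv (f ∘ suc) g)) (Σ<-suc n g) ⟨
  f 0 * Σ< (suc n) g + Σ< n (conv (f ∘ suc) g)                             ∎
  where open ≡-Reasoning

-- Row i of the triangle misses f(i) times the part of the sum of `g` from n - i to `N`, at most M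
-- ρ^i · c ρ^(n-i) = M c ρ^n, and there are `n` rows. In the induction `N` stays fixed while `f` is
-- shifted and `M` becomes `M * ρ`.
mertens : ∀ (g : Stream) N ρ c → 0ℚ ≤ ρ → 0ℚ ≤ c →
  (∀ m → m ℕ.≤ N → ∣ Σ< N g - Σ< m g ∣ ≤ c * ρ ^ m) →
  ∀ n → n ℕ.≤ N → ∀ f M → 0ℚ ≤ M → (∀ i → ∣ f i ∣ ≤ M * ρ ^ i) →
  ∣ Σ< n f * Σ< N g - Σ< n (conv f g) ∣ ≤ M * c * (ι n * ρ ^ n)
mertens g N ρ c 0≤ρ 0≤c tail zero n≤N f M 0≤M hf = ≤-reflexive
  (trans (cong ∣_∣ (solve 1 (λ x → con 0ℚ :* x :- con 0ℚ := con 0ℚ) refl (Σ< N g)))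
    (solve 2 (λ m c → con 0ℚ := m :* c :* (con 0ℚ :* con 1ℚ)) refl M c))
mertens g N ρ c 0≤ρ 0≤c tail (suc n) n<N f M 0≤M hf = begin
  ∣ Σ< (suc n) f * G - Σ< (suc n) (conv f g) ∣
    ≡⟨ cong ∣_∣ (trans (cong₂ (λ u v → u * G - v) (Σ<-suc n f) (Σ<-conv n f g))
         (solve 5 (λ a x t s d → (a :+ x) :* t :- (a :* s :+ d) := a :* (t :- s) :+ (x :* t :- d)) refl
           (f 0) (Σ< n (f ∘ suc)) G (Σ< (suc n) g) (Σ< n (conv (f ∘ suc) g)))) ⟩
  ∣ f 0 * (G - Σ< (suc n) g) + (Σ< n (f ∘ suc) * G - Σ< n (conv (f ∘ suc) g)) ∣
    ≤⟨ ∣p+q∣≤∣p∣+∣q∣ (f 0 * (G - Σ< (suc n) g)) (Σ< n (f ∘ suc) * G - Σ< n (conv (f ∘ suc) g)) ⟩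
  ∣ f 0 * (G - Σ< (suc n) g) ∣ + ∣ Σ< n (f ∘ suc) * G - Σ< n (conv (f ∘ suc) g) ∣
    ≤⟨ +-mono-≤
         (subst (_≤ M * 1ℚ * (c * ρ ^ suc n)) (sym (∣p*q∣≡∣p∣*∣q∣ (f 0) (G - Σ< (suc n) g)))
           (*-mono (0≤∣p∣ (f 0)) (0≤* 0≤c (0≤^ 0≤ρ (suc n))) (hf 0) (tail (suc n) n<N)))
         (mertens g N ρ c 0≤ρ 0≤c tail n (ℕ.≤-trans (ℕ.n≤1+n n) n<N) (f ∘ suc) (M * ρ) (0≤* 0≤M 0≤ρ)
           (λ i → ≤-respʳ (sym (*-assoc M ρ (ρ ^ i))) (hf (suc i)))) ⟩
  M * 1ℚ * (c * ρ ^ suc n) + M * ρ * c * (ι n * ρ ^ n)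
    ≡⟨ solve 5 (λ m c r i x → m :* con 1ℚ :* (c :* (r :* x)) :+ m :* r :* c :* (i :* x) := m :* c :* ((con 1ℚ :+ i) :* (r :* x))) refl
         M c ρ (ι n) (ρ ^ n) ⟩
  M * c * ((1ℚ + ι n) * ρ ^ suc n)
    ≡⟨ cong (λ z → M * c * (z * ρ ^ suc n)) (ι-suc n) ⟨
  M * c * (ι (suc n) * ρ ^ suc n) ∎
  where
  open ≤-Reasoning
  G = Σ< N g

-- `4/3` is 1 / (1 - ¼), the sum of the geometric series of ratio `¼`.
¼ 4/3 : ℚ
¼ = ½ * ½
4/3 = + 4 / 3

∣cosTerm∣≡dom : ∀ q k → ∣ cosTerm q k ∣ ≡ dom q k
∣cosTerm∣≡dom q k = begin
  ∣ (- 1ℚ) ^ k * q ^ (2 ℕ.* k) * invFact k ∣          ≡⟨ ∣p*q∣≡∣p∣*∣q∣ ((- 1ℚ) ^ k * q ^ (2 ℕ.* k)) (invFact k) ⟩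
  ∣ (- 1ℚ) ^ k * q ^ (2 ℕ.* k) ∣ * ∣ invFact k ∣      ≡⟨ cong₂ _*_ (∣p*q∣≡∣p∣*∣q∣ ((- 1ℚ) ^ k) (q ^ (2 ℕ.* k))) (0≤p⇒∣p∣≡p (0≤invFact k)) ⟩
  ∣ (- 1ℚ) ^ k ∣ * ∣ q ^ (2 ℕ.* k) ∣ * invFact k      ≡⟨ cong (_* invFact k) (cong₂ _*_ (trans (∣^∣ (- 1ℚ) k) (1^ k))
                                                          (trans (cong ∣_∣ (^-double q k)) (0≤p⇒∣p∣≡p (0≤^ (0≤² q) k)))) ⟩
  1ℚ * (q * q) ^ k * invFact k                        ≡⟨ cong (_* invFact k) (*-identityˡ ((q * q) ^ k)) ⟩
  dom q k                                             ∎
  where open ≡-Reasoning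

dom-double : ∀ B k → dom B k ≡ dom (2ℚ * B) k * ¼ ^ k
dom-double B k = trans (cong (λ z → z ^ k * invFact k)
    (solve 1 (λ b → b :* b := con 2ℚ :* b :* (con 2ℚ :* b) :* con ¼) refl B))
  (trans (cong (_* invFact k) (ℚ-CExp.^-distrib-* (2ℚ * B * (2ℚ * B)) ¼ k))
    (solve 3 (λ x y z → x :* y :* z := x :* z :* y) refl ((2ℚ * B * (2ℚ * B)) ^ k) (¼ ^ k) (invFact k)))

0≤¼^ : ∀ k → 0ℚ ≤ ¼ ^ k
0≤¼^ = 0≤^ (nonNegative⁻¹ ¼)

-- The terms of a convergent series are bounded, and doubling the argument
-- gains a factor 4^k.
cosTerm-geometric : ∀ B → ∃ λ M → 0ℚ ≤ M × ∀ q → ∣ q ∣ ≤ B → ∀ k → ∣ cosTerm q k ∣ ≤ M * ¼ ^ k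
cosTerm-geometric B = M , 0≤+ (<⇒≤ 0<b) (<⇒≤ 0<b) , λ q q≤B k →
  ≤-trans (∣cosTerm∣≤dom q≤B k) (subst (_≤ M * ¼ ^ k) (sym (dom-double B k))
    (*-monoʳ-≤-nonNeg (¼ ^ k) {{nonNegative (0≤¼^ k)}} (subst (_≤ M) (∣cosTerm∣≡dom (2ℚ * B) k) (term k))))
  where
  bd = bounded (cauchy-cos (cauchy-const (2ℚ * B)))
  b M : ℚ
  b = proj₁ bd
  M = b + b
  0<b : 0ℚ < b
  0<b = proj₁ (proj₂ bd)
  term : ∀ k → ∣ cosTerm (2ℚ * B) k ∣ ≤ M
  term k = ≤-trans
    (subst (λ z → ∣ z ∣ ≤ ∣ s₁ ∣ + ∣ - s₀ ∣) (solve 2 (λ a t → (a :+ t) :+ (:- a) := t) refl s₀ (cosTerm (2ℚ * B) k)) (∣p+q∣≤∣p∣+∣q∣ s₁ (- s₀)))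
    (+-mono-≤ (proj₂ (proj₂ bd) (suc k)) (subst (_≤ b) (sym (∣-p∣≡∣p∣ s₀)) (proj₂ (proj₂ bd) k)))
    where
    s₀ s₁ : ℚ
    s₀ = cosSum k (2ℚ * B)
    s₁ = cosSum (suc k) (2ℚ * B)

-- For a geometric majorant of ratio `¼` the second hypothesis of `tail-bound` holds with equality
-- for the constant `4/3`.
cosSum-tail-geometric : ∀ M → 0ℚ ≤ M → ∀ q → (∀ k → ∣ cosTerm q k ∣ ≤ M * ¼ ^ k) →
  ∀ n m → m ℕ.≤ n → ∣ cosSum n q - cosSum m q ∣ ≤ 4/3 * M * ¼ ^ m
cosSum-tail-geometric M 0≤M q hq n m m≤n = ≤-trans
  (subst (λ n → ∣ cosSum n q - cosSum m q ∣ ≤ 4/3 * (u m - u n)) (ℕ.m∸n+n≡m m≤n)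
    (tail-bound (cosTerm q) u 4/3 m (λ k _ → hq k)
      (λ k _ → ≤-reflexive (solve 2 (λ m x → m :* x := con 4/3 :* (m :* x :- m :* (con ¼ :* x))) refl M (¼ ^ k))) (n ℕ.∸ m)))
  (lin (4/3 * u n) (0≤* (nonNegative⁻¹ 4/3) (0≤* 0≤M (0≤¼^ n)))
    (solve 3 (λ m x y → con 4/3 :* m :* x := con 4/3 :* (m :* x :- y) :+ con 4/3 :* y) refl M (¼ ^ m) (u n)))
  where
  u : ℕ → ℚ
  u k = M * ¼ ^ k

n*¼^n≤½^n : ∀ n → ι n * ¼ ^ n ≤ ½ ^ n
n*¼^n≤½^n n = begin
  ι n * ¼ ^ n                  ≡⟨ cong (ι n *_) (ℚ-CExp.^-distrib-* ½ ½ n) ⟩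
  ι n * (½ ^ n * ½ ^ n)        ≡⟨ *-assoc (ι n) (½ ^ n) (½ ^ n) ⟨
  ι n * ½ ^ n * ½ ^ n          ≤⟨ *-monoʳ-≤-nonNeg (½ ^ n) {{nonNegative 0≤h}}
                                    (≤-trans (*-monoʳ-≤-nonNeg (½ ^ n) {{nonNegative 0≤h}} (ι-mono (ℕ.n≤1+n n))) (½^-bound n)) ⟩
  1ℚ * ½ ^ n                   ≡⟨ *-identityˡ (½ ^ n) ⟩
  ½ ^ n                        ∎
  where
  open ≤-Reasoning
  0≤h : 0ℚ ≤ ½ ^ n
  0≤h = 0≤^ (nonNegative⁻¹ ½) n

-- `mertens` with ρ = `¼`; the factor `n` is absorbed at the price of the weaker ratio `½`. The
-- constant must depend on `B` alone, because in `cos-product` the arguments change with `n`.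
cosSum-product : ∀ B → ∃ λ K → 0ℚ ≤ K × ∀ p q → ∣ p ∣ ≤ B → ∣ q ∣ ≤ B → ∀ n →
  ∣ 2ℚ * (cosSum n p * cosSum n q) - (cosSum n (p + q) + cosSum n (p - q)) ∣ ≤ K * ½ ^ n
cosSum-product B = K , 0≤* (nonNegative⁻¹ 2ℚ) (0≤* 0≤M 0≤c) , λ p q p≤B q≤B n → begin
  ∣ 2ℚ * (cosSum n p * cosSum n q) - (cosSum n (p + q) + cosSum n (p - q)) ∣
    ≡⟨ cong (λ z → ∣ 2ℚ * (cosSum n p * cosSum n q) - z ∣) (sums p q n) ⟩
  ∣ 2ℚ * (cosSum n p * cosSum n q) - 2ℚ * Σ< n (conv (cosTerm p) (cosTerm q)) ∣
    ≡⟨ trans (cong ∣_∣ (solve 2 (λ x y → con 2ℚ :* x :- con 2ℚ :* y := con 2ℚ :* (x :- y)) refl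
         (cosSum n p * cosSum n q) (Σ< n (conv (cosTerm p) (cosTerm q)))))
         (∣p*q∣≡∣p∣*∣q∣ 2ℚ (cosSum n p * cosSum n q - Σ< n (conv (cosTerm p) (cosTerm q)))) ⟩
  2ℚ * ∣ cosSum n p * cosSum n q - Σ< n (conv (cosTerm p) (cosTerm q)) ∣
    ≤⟨ *-monoʳ {2ℚ} (nonNegative⁻¹ 2ℚ) (mertens (cosTerm q) n ¼ (4/3 * M) (nonNegative⁻¹ ¼) 0≤c
         (cosSum-tail-geometric M 0≤M q (hM q q≤B) n) n ℕ.≤-refl (cosTerm p) M 0≤M (hM p p≤B)) ⟩
  2ℚ * (M * (4/3 * M) * (ι n * ¼ ^ n))
    ≤⟨ *-monoʳ {2ℚ} (nonNegative⁻¹ 2ℚ) (*-monoʳ (0≤* 0≤M 0≤c) (n*¼^n≤½^n n)) ⟩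
  2ℚ * (M * (4/3 * M) * ½ ^ n)
    ≡⟨ *-assoc 2ℚ (M * (4/3 * M)) (½ ^ n) ⟨
  K * ½ ^ n ∎
  where
  open ≤-Reasoning
  geometric = cosTerm-geometric B
  M K : ℚ
  M = proj₁ geometric
  K = 2ℚ * (M * (4/3 * M))
  0≤M : 0ℚ ≤ M
  0≤M = proj₁ (proj₂ geometric)
  hM = proj₂ (proj₂ geometric)
  0≤c : 0ℚ ≤ 4/3 * M
  0≤c = 0≤* (nonNegative⁻¹ 4/3) 0≤M
  sums : ∀ p q n → cosSum n (p + q) + cosSum n (p - q) ≡ 2ℚ * Σ< n (conv (cosTerm p) (cosTerm q))
  sums p q n = trans (sym (Σ<-+ n (cosTerm (p + q)) (cosTerm (p - q))))
    (trans (Σ<-cong n (λ k → sym (conv-cosTerm p q k))) (Σ<-* n 2ℚ (conv (cosTerm p) (cosTerm q))))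

-- The ring of real numbers

≈-by : ∀ {x y} K → 0ℚ < K →
  (∀ ε → 0ℚ < ε → ∃ λ N → ∀ n → N ℕ.≤ n → ∣ seq x n - seq y n ∣ ≤ K * ε) → x ≈ᵣ y
≈-by {x} {y} K 0<K h = mk≈ λ ε 0<ε →
  let N , hN = h (½ * ε * recip K 0<K) (0<* (0<* (positive⁻¹ ½) 0<ε) (0<recip K 0<K))
  in N , λ n p → ≤-<-trans (hN n p) (small ε 0<ε)
  where
  small : ∀ ε → 0ℚ < ε → K * (½ * ε * recip K 0<K) < ε
  small ε 0<ε = subst₂ _<_
    (trans (+-identityʳ (½ * ε)) (sym (trans
      (solve 3 (λ k e r → k :* (con ½ :* e :* r) := con ½ :* e :* (k :* r)) refl K ε (recip K 0<K))
      (trans (cong (½ * ε *_) (*-recip K 0<K)) (*-identityʳ (½ * ε))))))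
    (solve 1 (λ e → con ½ :* e :+ con ½ :* e := e) refl ε)
    (+-monoʳ-< (½ * ε) (0<* (positive⁻¹ ½) 0<ε))

≈-pointwise-from : ∀ {x y} N → (∀ n → N ℕ.≤ n → seq x n ≡ seq y n) → x ≈ᵣ y
≈-pointwise-from {x} {y} N e = mk≈ λ ε 0<ε → N , λ n p →
  subst (λ z → ∣ z ∣ < ε) (sym (trans (cong (_- seq y n) (e n p)) (+-inverseʳ (seq y n)))) 0<ε

≈-pointwise : ∀ {x y} → (∀ n → seq x n ≡ seq y n) → x ≈ᵣ y
≈-pointwise e = ≈-pointwise-from 0 (λ n _ → e n)

≈-geometric : ∀ {x y} K → 0ℚ ≤ K → (∀ n → ∣ seq x n - seq y n ∣ ≤ K * ½ ^ n) → x ≈ᵣ y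
≈-geometric {x} {y} K 0≤K h = ≈-by (K + 1ℚ) (+-mono-≤-< 0≤K (positive⁻¹ 1ℚ)) λ ε 0<ε →
  let N , hN = 4*½^-vanishes ε 0<ε
  in N , λ n p → ≤-trans (h n) (≤-trans (*-monoʳ 0≤K (≤-trans (½^≤4*½^ n) (hN n p)))
       (lin ε (<⇒≤ 0<ε) (solve 2 (λ k e → (k :+ con 1ℚ) :* e := k :* e :+ e) refl K ε)))
  where
  ½^≤4*½^ : ∀ n → ½ ^ n ≤ 4ℚ * ½ ^ n
  ½^≤4*½^ n = lin (3ℚ * ½ ^ n) (0≤* (nonNegative⁻¹ 3ℚ) (0≤^ (nonNegative⁻¹ ½) n))
    (solve 1 (λ x → con 4ℚ :* x := x :+ con 3ℚ :* x) refl (½ ^ n))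

≈-refl : ∀ {x} → x ≈ᵣ x
≈-refl = ≈-pointwise λ _ → refl

≈-sym : ∀ {x y} → x ≈ᵣ y → y ≈ᵣ x
≈-sym {x} {y} (mk≈ h) = mk≈ λ ε 0<ε → let N , hN = h ε 0<ε in
  N , λ n p → subst (_< ε) (∣-∣-swap (seq x n) (seq y n)) (hN n p)

≈-trans : ∀ {x y z} → x ≈ᵣ y → y ≈ᵣ z → x ≈ᵣ z
≈-trans {x} {y} {z} (mk≈ h) (mk≈ k) = ≈-by 2ℚ (positive⁻¹ 2ℚ) λ ε 0<ε →
  let M , hM = h ε 0<ε
      N , hN = k ε 0<ε
  in M ℕ.⊔ N , λ n p → ≤-trans (∣-∣-triangle (seq x n) (seq y n) (seq z n))
    (≤-respʳ (solve 1 (λ e → e :+ e := con 2ℚ :* e) refl ε)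
      (+-mono-≤ (<⇒≤ (hM n (ℕ.m⊔n≤o⇒m≤o M N p))) (<⇒≤ (hN n (ℕ.m⊔n≤o⇒n≤o M N p)))))

+ᵣ-cong : ∀ {x x′ y y′} → x ≈ᵣ x′ → y ≈ᵣ y′ → x +ᵣ y ≈ᵣ x′ +ᵣ y′
+ᵣ-cong {x} {x′} {y} {y′} (mk≈ h) (mk≈ k) = ≈-by 2ℚ (positive⁻¹ 2ℚ) λ ε 0<ε →
  let M , hM = h ε 0<ε
      N , hN = k ε 0<ε
  in M ℕ.⊔ N , λ n p → ≤-trans
    (subst (λ z → ∣ z ∣ ≤ ∣ seq x n - seq x′ n ∣ + ∣ seq y n - seq y′ n ∣)
      (solve 4 (λ a b c d → (a :- b) :+ (c :- d) := (a :+ c) :- (b :+ d)) refl (seq x n) (seq x′ n) (seq y n) (seq y′ n))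
      (∣p+q∣≤∣p∣+∣q∣ (seq x n - seq x′ n) (seq y n - seq y′ n)))
    (≤-respʳ (solve 1 (λ e → e :+ e := con 2ℚ :* e) refl ε)
      (+-mono-≤ (<⇒≤ (hM n (ℕ.m⊔n≤o⇒m≤o M N p))) (<⇒≤ (hN n (ℕ.m⊔n≤o⇒n≤o M N p)))))

-ᵣ-cong : ∀ {x y} → x ≈ᵣ y → -ᵣ x ≈ᵣ -ᵣ y
-ᵣ-cong {x} {y} (mk≈ h) = mk≈ λ ε 0<ε → let N , hN = h ε 0<ε in N , λ n p →
  subst (_< ε) (trans (∣-∣-swap (seq x n) (seq y n))
    (cong ∣_∣ (solve 2 (λ a b → b :- a := :- a :- :- b) refl (seq x n) (seq y n)))) (hN n p)

*ᵣ-cong : ∀ {x x′ y y′} → x ≈ᵣ x′ → y ≈ᵣ y′ → x *ᵣ y ≈ᵣ x′ *ᵣ y′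
*ᵣ-cong {x} {x′} {y} {y′} (mk≈ h) (mk≈ k) =
  let B , 0<B , hB = bounded (cauchy x)
      C , 0<C , hC = bounded (cauchy y′)
  in ≈-by (B + C) (+-mono-< 0<B 0<C) λ ε 0<ε →
  let M , hM = h ε 0<ε
      N , hN = k ε 0<ε
  in M ℕ.⊔ N , λ n p →
  let a = seq x n
      a′ = seq x′ n
      b = seq y n
      b′ = seq y′ n
  in ≤-trans
    (subst (λ z → ∣ z ∣ ≤ ∣ a * (b - b′) ∣ + ∣ b′ * (a - a′) ∣)
      (solve 4 (λ a a′ b b′ → a :* (b :- b′) :+ b′ :* (a :- a′) := a :* b :- a′ :* b′) refl a a′ b b′)
      (∣p+q∣≤∣p∣+∣q∣ (a * (b - b′)) (b′ * (a - a′))))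
    (≤-respʳ (sym (*-distribʳ-+ ε B C)) (+-mono-≤
      (subst (_≤ B * ε) (sym (∣p*q∣≡∣p∣*∣q∣ a (b - b′)))
        (*-mono (0≤∣p∣ a) (<⇒≤ 0<ε) (hB n) (<⇒≤ (hN n (ℕ.m⊔n≤o⇒n≤o M N p)))))
      (subst (_≤ C * ε) (sym (∣p*q∣≡∣p∣*∣q∣ b′ (a - a′)))
        (*-mono (0≤∣p∣ b′) (<⇒≤ 0<ε) (hC n) (<⇒≤ (hM n (ℕ.m⊔n≤o⇒m≤o M N p)))))))

ℝ-isCommutativeRing : IsCommutativeRing _≈ᵣ_ _+ᵣ_ _*ᵣ_ -ᵣ_ (fromℚ 0ℚ) (fromℚ 1ℚ)
ℝ-isCommutativeRing = record
  { isRing = record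
    { +-isAbelianGroup = record
      { isGroup = record
        { isMonoid = record
          { isSemigroup = record
            { isMagma = record
              { isEquivalence = record { refl = ≈-refl ; sym = ≈-sym ; trans = ≈-trans }
              ; ∙-cong = +ᵣ-cong }
            ; assoc = λ x y z → ≈-pointwise λ n → +-assoc (seq x n) (seq y n) (seq z n) }
          ; identity = (λ x → ≈-pointwise λ n → +-identityˡ (seq x n)) , (λ x → ≈-pointwise λ n → +-identityʳ (seq x n)) }
        ; inverse = (λ x → ≈-pointwise λ n → +-inverseˡ (seq x n)) , (λ x → ≈-pointwise λ n → +-inverseʳ (seq x n))
        ; ⁻¹-cong = -ᵣ-cong }
      ; comm = λ x y → ≈-pointwise λ n → +-comm (seq x n) (seq y n) }
    ; *-cong = *ᵣ-cong
    ; *-assoc = λ x y z → ≈-pointwise λ n → *-assoc (seq x n) (seq y n) (seq z n)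
    ; *-identity = (λ x → ≈-pointwise λ n → *-identityˡ (seq x n)) , (λ x → ≈-pointwise λ n → *-identityʳ (seq x n))
    ; distrib = (λ x y z → ≈-pointwise λ n → *-distribˡ-+ (seq x n) (seq y n) (seq z n))
              , (λ x y z → ≈-pointwise λ n → *-distribʳ-+ (seq x n) (seq y n) (seq z n)) }
  ; *-comm = λ x y → ≈-pointwise λ n → *-comm (seq x n) (seq y n) }

-- Eventually the terms of `x` are at least the gap g, so those of `y` are at most 1 / g times those
-- of the product in absolute value.
<ᵣ-cancel : ∀ x y → fromℚ 0ℚ <ᵣ x → x *ᵣ y ≈ᵣ fromℚ 0ℚ → y ≈ᵣ fromℚ 0ℚ
<ᵣ-cancel x y (mk< g 0<g (M , hM)) (mk≈ h) = ≈-by (recip g 0<g) (0<recip g 0<g) λ ε 0<ε →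
  let N , hN = h ε 0<ε in M ℕ.⊔ N , λ n p →
  let a = seq x n
      b = seq y n
      r = recip g 0<g
      g≤a : g ≤ a
      g≤a = ≤-respʳ (+-identityʳ a) (hM n (ℕ.m⊔n≤o⇒m≤o M N p))
      open ≤-Reasoning
  in begin
    ∣ b - 0ℚ ∣                     ≡⟨ cong ∣_∣ (+-identityʳ b) ⟩
    ∣ b ∣                          ≡⟨ *-identityˡ ∣ b ∣ ⟨
    1ℚ * ∣ b ∣                     ≡⟨ cong (_* ∣ b ∣) (*-recip g 0<g) ⟨
    g * r * ∣ b ∣                  ≡⟨ solve 3 (λ g r b → g :* r :* b := r :* (g :* b)) refl g r ∣ b ∣ ⟩
    r * (g * ∣ b ∣)                ≤⟨ *-monoʳ (<⇒≤ (0<recip g 0<g)) (*-monoʳ-≤-nonNeg ∣ b ∣ {{nonNegative (0≤∣p∣ b)}} (≤-trans g≤a (a≤∣a∣ a))) ⟩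
    r * (∣ a ∣ * ∣ b ∣)            ≡⟨ cong (r *_) (trans (sym (∣p*q∣≡∣p∣*∣q∣ a b)) (cong ∣_∣ (sym (+-identityʳ (a * b))))) ⟩
    r * ∣ a * b - 0ℚ ∣             ≤⟨ *-monoʳ (<⇒≤ (0<recip g 0<g)) (<⇒≤ (hN n (ℕ.m⊔n≤o⇒n≤o M N p))) ⟩
    r * ε                          ∎

cos-product : ∀ x y → fromℚ 2ℚ *ᵣ (cos x *ᵣ cos y) ≈ᵣ cos (x +ᵣ y) +ᵣ cos (x -ᵣ y)
cos-product x y =
  let B , 0<B , hB = bounded (cauchy x)
      C , 0<C , hC = bounded (cauchy y)
      K , 0≤K , hK = cosSum-product (B + C)
  in ≈-geometric K 0≤K λ n → hK (seq x n) (seq y n)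
       (≤-trans (hB n) (lin C (<⇒≤ 0<C) refl))
       (≤-trans (hC n) (lin B (<⇒≤ 0<B) (+-comm B C))) n

-- The constant term is the whole sum; at index 0 the sum is still empty, hence the bound on `n`.
cosSum-zero : ∀ n → 1 ℕ.≤ n → cosSum n 0ℚ ≡ 1ℚ
cosSum-zero (suc zero)    _ = refl
cosSum-zero (suc (suc n)) _ = cong₂ _+_ (cosSum-zero (suc n) (ℕ.s≤s ℕ.z≤n))
  (trans (cong (λ z → (- 1ℚ) ^ suc n * z * invFact (suc n)) (trans (^-double 0ℚ (suc n)) (*-zeroˡ (0ℚ ^ n))))
    (solve 2 (λ a b → a :* con 0ℚ :* b := con 0ℚ) refl ((- 1ℚ) ^ suc n) (invFact (suc n))))

-- Multiples of π / 7

-- Angles are measured in units of π / 2, so that the known zero sits at 1 and sums of angles are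
-- sums of rationals.
2cos : ℚ → ℝ
2cos q = fromℚ 2ℚ *ᵣ cos (fromℚ q *ᵣ halfπ)

2cos-product : ∀ p q → 2cos p *ᵣ 2cos q ≈ᵣ 2cos (p + q) +ᵣ 2cos (p - q)
2cos-product p q = ≈-trans
  (≈-pointwise λ n → solve 2 (λ x y → (con 2ℚ :* x) :* (con 2ℚ :* y) := con 2ℚ :* (con 2ℚ :* (x :* y))) refl
    (seq (cos x) n) (seq (cos y) n))
  (≈-trans (*ᵣ-cong (≈-refl {fromℚ 2ℚ}) (cos-product x y))
    (≈-pointwise λ n → trans
      (solve 2 (λ x y → con 2ℚ :* (x :+ y) := con 2ℚ :* x :+ con 2ℚ :* y) refl (seq (cos (x +ᵣ y)) n) (seq (cos (x -ᵣ y)) n))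
      (cong₂ (λ s t → 2ℚ * cosSum n s + 2ℚ * cosSum n t)
        (sym (*-distribʳ-+ (halfπ-approx n) p q))
        (solve 3 (λ p q h → p :* h :- q :* h := (p :- q) :* h) refl p q (halfπ-approx n)))))
  where
  x y : ℝ
  x = fromℚ p *ᵣ halfπ
  y = fromℚ q *ᵣ halfπ

2cos-zero : 2cos 0ℚ ≈ᵣ fromℚ 2ℚ
2cos-zero = ≈-pointwise-from 1 λ n 1≤n → cong (λ z → 2ℚ * z)
  (trans (cong (cosSum n) (*-zeroˡ (halfπ-approx n))) (cosSum-zero n 1≤n))

2cos-one : 2cos 1ℚ ≈ᵣ fromℚ 0ℚ
2cos-one = ≈-trans {y = fromℚ 2ℚ *ᵣ cos halfπ}
  (≈-pointwise λ n → cong (λ z → 2ℚ * cosSum n z) (*-identityˡ (halfπ-approx n)))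
  (≈-trans {y = fromℚ 2ℚ *ᵣ fromℚ 0ℚ} (*ᵣ-cong {fromℚ 2ℚ} {fromℚ 2ℚ} {cos halfπ} {fromℚ 0ℚ} ≈-refl cos-halfπ) (≈-pointwise λ _ → refl))

cos-π/14-positive : fromℚ 0ℚ <ᵣ cos (fromℚ (+ 1 / 7) *ᵣ halfπ)
cos-π/14-positive = cos-positive (fromℚ (+ 1 / 7) *ᵣ halfπ)
  -- From index 3 on the approximants h of π / 2 are at least 1, so the distances 8h / 7 and 6h / 7
  -- to the two endpoints exceed `½`.
  (mk< ½ (positive⁻¹ ½) (3 , λ n 3≤n →
    lin ((+ 8 / 7) * (halfπ-approx n - 1ℚ) + (+ 8 / 7 - ½)) (0≤+ (0≤* (nonNegative⁻¹ (+ 8 / 7)) (0≤h-1 n 3≤n)) (nonNegative⁻¹ (+ 8 / 7 - ½)))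
      (solve 1 (λ h → con (+ 1 / 7) :* h :- (:- h) := con ½ :+ (con (+ 8 / 7) :* (h :- con 1ℚ) :+ con (+ 8 / 7 - ½))) refl (halfπ-approx n))))
  (mk< ½ (positive⁻¹ ½) (3 , λ n 3≤n →
    lin ((+ 6 / 7) * (halfπ-approx n - 1ℚ) + (+ 6 / 7 - ½)) (0≤+ (0≤* (nonNegative⁻¹ (+ 6 / 7)) (0≤h-1 n 3≤n)) (nonNegative⁻¹ (+ 6 / 7 - ½)))
      (solve 1 (λ h → h :- con (+ 1 / 7) :* h := con ½ :+ (con (+ 6 / 7) :* (h :- con 1ℚ) :+ con (+ 6 / 7 - ½))) refl (halfπ-approx n))))
  where
  0≤h-1 : ∀ n → 3 ℕ.≤ n → 0ℚ ≤ halfπ-approx n - 1ℚ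
  0≤h-1 n 3≤n = 0≤-diff (IsApproxZero.1≤r (halfπ-approx-spec n 3≤n))

2cos-cancel : ∀ y → 2cos (+ 1 / 7) *ᵣ y ≈ᵣ fromℚ 0ℚ → y ≈ᵣ fromℚ 0ℚ
2cos-cancel y e = <ᵣ-cancel c y cos-π/14-positive (≈-trans
  (≈-pointwise λ n → solve 2 (λ c y → c :* y := con ½ :* (con 2ℚ :* c :* y)) refl (seq c n) (seq y n))
  (≈-trans (*ᵣ-cong {fromℚ ½} {fromℚ ½} {2cos (+ 1 / 7) *ᵣ y} {fromℚ 0ℚ} ≈-refl e) (≈-pointwise λ _ → refl)))
  where
  c : ℝ
  c = cos (fromℚ (+ 1 / 7) *ᵣ halfπ)

2cos-π : ∀ p q → p * 2ℚ ≡ q → fromℚ (+ 2 / 1) *ᵣ cos (fromℚ p *ᵣ π) ≈ᵣ 2cos q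
2cos-π p q e = ≈-pointwise λ n → cong (λ z → 2ℚ * cosSum n z)
  (trans (sym (*-assoc p 2ℚ (halfπ-approx n))) (cong (_* halfπ-approx n) e))

module H = Heptagon _≈ᵣ_ _+ᵣ_ _*ᵣ_ -ᵣ_ _^ᵣ_ fromℚ ℝ-isCommutativeRing
  (λ _ _ → ≈-pointwise λ _ → refl) (λ _ _ → ≈-pointwise λ _ → refl) (λ _ → ≈-pointwise λ _ → refl)
  (λ _ → ≈-pointwise λ _ → refl) (λ _ _ → ≈-pointwise λ _ → refl)
  2cos 2cos-product 2cos-zero 2cos-one 2cos-cancel

-- Here and below ≈-pointwise λ _ → refl stands for a conversion at type ℝ, where
-- the type checker would compare the Cauchy proofs as well.
α≈ : α ≈ᵣ 2cos (+ 4 / 7)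
α≈ = ≈-trans (≈-pointwise λ _ → refl) (2cos-π (+ 2 / 7) (+ 4 / 7) refl)

β≈ : β ≈ᵣ 2cos (+ 8 / 7)
β≈ = ≈-trans (≈-pointwise λ _ → refl) (2cos-π (+ 4 / 7) (+ 8 / 7) refl)

γ≈ : γ ≈ᵣ 2cos (+ 16 / 7)
γ≈ = ≈-trans (≈-pointwise λ _ → refl) (2cos-π (+ 8 / 7) (+ 16 / 7) refl)

module Sevenths = H.Roots α β γ α≈ β≈ γ≈

theorem21 :
  (A 0 ≡ + 3 / 1) × (A 1 ≡ + 5 / 1) × (A 2 ≡ + 13 / 1)
  × (∀ n → A (n ℕ.+ 3) ≡ (+ 5 / 1) * A (n ℕ.+ 2) - (+ 6 / 1) * A (n ℕ.+ 1) + A n)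
  -- α, β, γ are the zeros of x³ + x² - 2x - 1.
  × (∀ x → (x -ᵣ α) *ᵣ (x -ᵣ β) *ᵣ (x -ᵣ γ) ≈ᵣ x ^ᵣ 3 +ᵣ x ^ᵣ 2 -ᵣ fromℚ (+ 2 / 1) *ᵣ x -ᵣ fromℚ (+ 1 / 1))
  × (∀ n → fromℚ (A n) ≈ᵣ A₂ n)
  × (∀ n → fromℚ (A n) ≈ᵣ
      fromℚ (+ 2 / 1) ^ᵣ (2 ℕ.* n)
        *ᵣ (cos (fromℚ (+ 1 / 7) *ᵣ π) ^ᵣ (2 ℕ.* n)
            +ᵣ cos (fromℚ (+ 2 / 7) *ᵣ π) ^ᵣ (2 ℕ.* n)
            +ᵣ cos (fromℚ (+ 3 / 7) *ᵣ π) ^ᵣ (2 ℕ.* n)))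
-- The initial values come from evaluating the enumeration, which for `A 2` runs through 6^5 vertex
-- vectors.
theorem21 = refl , refl , refl , A-recurrence
  , (λ x → ≈-trans (≈-pointwise λ _ → refl) (≈-trans (Sevenths.factorisation x) (≈-pointwise λ _ → refl)))
  , A≈A₂
  , λ n → ≈-trans (Sevenths.A≈powerSum A refl refl refl A-recurrence n)
      (≈-trans (Sevenths.powerSum-cosines (cos (fromℚ (+ 1 / 7) *ᵣ π)) (cos (fromℚ (+ 2 / 7) *ᵣ π)) (cos (fromℚ (+ 3 / 7) *ᵣ π))
        (2cos-π (+ 1 / 7) (+ 2 / 7) refl) (2cos-π (+ 2 / 7) (+ 4 / 7) refl) (2cos-π (+ 3 / 7) (+ 6 / 7) refl) n)
        (≈-pointwise λ _ → refl))
  where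
  A≈A₂ : ∀ n → fromℚ (A n) ≈ᵣ A₂ n
  A≈A₂ n = ≈-trans (Sevenths.A≈powerSum A refl refl refl A-recurrence n) (≈-pointwise λ _ → refl)
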